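{- Let $p$ be a prime and $n\ge 1$, and let $M_n$ be the group whose elements are triples $[\vec{x},\vec{y},z]$ with $\vec{x},\vec{y}\in\mathbb{F}_p^n$, $z\in\mathbb{F}_p$, with multiplication \[ [\vec{x},\vec{y},z]\cdot[\vec{x}',\vec{y}',z'] = [\vec{x}+\vec{x}',\ \vec{y}+\vec{y}',\ z+z'+\langle\vec{x},\vec{y}'\rangle + f(\vec{y},\vec{y}')], \] where $\langle\vec{x},\vec{y}'\rangle=\sum_{i=1}^n x_iy_i'$ and $f(\vec{y},\vec{y}')=\sum_{i=1}^n\left\lfloor \frac{(y_i \bmod p)+(y_i'\bmod p)}{p}\right\rfloor$ (taken in $\mathbb{F}_p$). For every $\varepsilon>0$ there exists a positive integer $n_0=n_0(\varepsilon)$ such that for every prime $p$ and every $n\ge n_0$: if $B\subseteq M_n$ is a brick with $|B|>|M_n|^{3/4+\varepsilon}$, then $B\cdot B=\{b b' : b,b'\in B\}$ contains at least $|B|/p$ cosets of the center $G'=[\vec{0},\vec{0},\mathbb{F}_p]=\{[\vec 0,\vec 0,z]: z\in\mathbb{F}_p\}$ of $M_n$ (a nontrivial subgroup).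
   Context: For $y\in\mathbb{F}_p$, $y\bmod p\in\{0,1,\dots,p-1\}$ denotes $y$ regarded as an integer. This group $M_n$ (of order $p^{2n+1}$) is isomorphic to the extra special group $\langle a_1,b_1,\dots,a_n,b_n,c \mid [a_i,a_j]=[b_i,b_j]=1,\ [a_i,b_j]=1\ (i\ne j),\ [a_i,c]=[b_i,c]=1,\ [a_i,b_i]=c,\ a_i^p=c^p=1,\ b_i^p=c\rangle$. A subset $B\subseteq M_n$ is a brick if $B=\{[\vec{x},\vec{y},z]: \vec{x}\in X_1\times\dots\times X_n,\ \vec{y}\in Y_1\times\dots\times Y_n,\ z\in Z\}$ for some nonempty subsets $X_i,Y_i,Z\subseteq\mathbb{F}_p$. -}

module Defs where

open import Data.Nat using (ℕ; zero; suc; _+_; _*_; _/_; NonZero)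
open import Data.Nat.DivMod using (_mod_)
open import Data.Fin using (Fin; toℕ)
open import Data.Fin.Subset using (Subset; _∈_; ∣_∣; Nonempty)
open import Data.Vec using (Vec; []; _∷_; lookup; zipWith)
open import Data.Product using (_×_; _,_; ∃; ∃-syntax)
open import Data.List using (List; length)
open import Data.List.Relation.Unary.All using (All)
open import Data.List.Relation.Unary.Unique.Propositional using (Unique)
open import Relation.Binary.PropositionalEquality using (_≡_)

module _ {p : ℕ} {{_ : NonZero p}} where

  infixl 6 _+ₚ_
  infixl 7 _*ₚ_

  _+ₚ_ : Fin p → Fin p → Fin p
  a +ₚ b = (toℕ a + toℕ b) mod p

  _*ₚ_ : Fin p → Fin p → Fin p
  a *ₚ b = (toℕ a * toℕ b) mod p

  dot : ∀ {n} → Vec (Fin p) n → Vec (Fin p) n → Fin p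
  dot []       []       = 0 mod p
  dot (a ∷ as) (b ∷ bs) = a *ₚ b +ₚ dot as bs

  carry : ∀ {n} → Vec (Fin p) n → Vec (Fin p) n → Fin p
  carry []       []       = 0 mod p
  carry (a ∷ as) (b ∷ bs) = ((toℕ a + toℕ b) / p) mod p +ₚ carry as bs

  M : ℕ → Set
  M n = Vec (Fin p) n × Vec (Fin p) n × Fin p

  _·_ : ∀ {n} → M n → M n → M n
  (x , y , z) · (x' , y' , z') =
    zipWith _+ₚ_ x x' , zipWith _+ₚ_ y y' , z +ₚ z' +ₚ dot x y' +ₚ carry y y'

  orderM : ℕ → ℕ
  orderM n = p Data.Nat.^ (2 * n + 1)

-- A brick is given by subsets X₁…Xₙ, Y₁…Yₙ, Z of 𝔽ₚ (nonemptiness is a separate predicate).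
record Brick (p n : ℕ) : Set where
  constructor brick
  field
    X : Vec (Subset p) n
    Y : Vec (Subset p) n
    Z : Subset p

open Brick public

NonemptyBrick : ∀ {p n} → Brick p n → Set
NonemptyBrick B = (∀ i → Nonempty (lookup (X B) i)) × (∀ i → Nonempty (lookup (Y B) i)) × Nonempty (Z B)

_∈B_ : ∀ {p n} → Vec (Fin p) n × Vec (Fin p) n × Fin p → Brick p n → Set
(x , y , z) ∈B B = (∀ i → lookup x i ∈ lookup (X B) i) × (∀ i → lookup y i ∈ lookup (Y B) i) × z ∈ Z B

prodSizes : ∀ {p n} → Vec (Subset p) n → ℕ
prodSizes []       = 1
prodSizes (S ∷ Ss) = ∣ S ∣ * prodSizes Ss

brickSize : ∀ {p n} → Brick p n → ℕ
brickSize B = prodSizes (X B) * prodSizes (Y B) * ∣ Z B ∣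

module _ {p : ℕ} {{_ : NonZero p}} where

  _∈BB_ : ∀ {n} → M n → Brick p n → Set
  g ∈BB B = ∃[ b ] ∃[ b' ] (b ∈B B × b' ∈B B × (b · b') ≡ g)

  -- the coset [x , y , 𝔽ₚ] = [x , y , 0]·G' is contained in B·B
  CosetIn : ∀ {n} → Brick p n → Vec (Fin p) n × Vec (Fin p) n → Set
  CosetIn B (x , y) = ∀ (z : Fin p) → (x , y , z) ∈BB B

  -- B·B contains at least k/p cosets of G' (k·… real inequality cleared of p):
  -- there are m distinct cosets inside B·B with m · p ≥ k.
  ContainsAtLeastCosetsOver-p : ∀ {n} → Brick p n → ℕ → Set
  ContainsAtLeastCosetsOver-p {n} B k =
    ∃[ L ] (Unique {A = Vec (Fin p) n × Vec (Fin p) n} L × All (CosetIn B) L × k Data.Nat.≤ length L * p)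

{-# OPTIONS --safe #-}
module Submission where

-- Write r_X(u) for the number of x ∈ X with u − x ∈ X.  The coset over (u , v) lies in B·B as soon
-- as the sums Σ xᵢyᵢ' + carry(vᵢ − yᵢ' , yᵢ'), with xᵢ , uᵢ − xᵢ ∈ Xᵢ and yᵢ' , vᵢ − yᵢ' ∈ Yᵢ, fill 𝔽ₚ.
-- Convolving a mean-zero function with the values of one coordinate multiplies its ℓ²-norm squared
-- by at most p R, R = r_X(u) r_Y(v) (Cauchy–Schwarz; the carry depends on y' only and is harmless),
-- while it multiplies the main term by R.  So k coordinates suffice when the product of their R
-- exceeds p^(k+2), e.g. when R^E ≥ p^(E+1) in each of k = 2E + 1 coordinates ("rich").
--
-- The size hypothesis forces |Xᵢ||Yᵢ| ≥ p^(3/2+ε) in many coordinates.  There, averaging r_X and r_Y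
-- shows that a constant proportion of the pairs (uᵢ , vᵢ) is rich, and all are when Xᵢ , Yᵢ nearly
-- fill 𝔽ₚ.  Otherwise Cauchy–Davenport makes the sumsets larger than the sets by a constant factor, so
-- the coordinates not used as rich ones make up for the loss, and at least Π|Xᵢ||Yᵢ| ≥ |B|/p cosets remain.

open import Defs
open import Algebra.Bundles using (CommutativeRing)
open import Algebra.Structures using (IsCommutativeRing)
open import Data.Bool.Base using (Bool; true; false; _∧_; _∨_)
import Data.Bool.Properties as Bool
open import Data.Empty using (⊥-elim)
open import Data.Fin.Base using (Fin; zero; suc; toℕ; punchOut)
import Data.Fin.Permutation as Perm
import Data.Fin.Properties as Fin
open import Data.Fin.Subset using (Subset; ∣_∣; _∈_; Nonempty; inside; outside)
import Data.Fin.Subset.Properties as Subset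
open import Data.Integer.Base as ℤ using (ℤ; +_; 0ℤ; 1ℤ; -1ℤ)
import Data.Integer.Properties as ℤ
import Data.Integer.Tactic.RingSolver as ℤ-Solver
open import Data.List.Base as List using (List; length; cartesianProductWith; filter; tabulate; allFin)
import Data.List.Properties as List
open import Data.List.Relation.Unary.All as All using (All)
import Data.List.Relation.Unary.All.Properties as All
import Data.List.Relation.Unary.AllPairs as AllPairs
open import Data.List.Relation.Unary.Unique.Propositional using (Unique)
import Data.List.Relation.Unary.Unique.Propositional.Properties as Unique
open import Data.Nat.Base as ℕ using (ℕ; zero; suc; _+_; _*_; _∸_; _^_; _/_; _%_; _≤_; _<_; z≤n; s≤s; NonZero)
open import Data.Nat.DivMod using (_mod_; m%n<n; m<n⇒m%n≡m; m*n%n≡0; n%n≡0; %-distribˡ-+; %-distribˡ-*)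
open import Data.Nat.Divisibility using (_∣_; ∣⇒≤; m%n≡0⇒n∣m)
open import Data.Nat.Primality using (Prime; prime⇒nonZero; prime⇒nonTrivial; euclidsLemma)
import Data.Nat.Properties as ℕ
open import Data.Nat.Tactic.RingSolver using (solve-∀)
open import Data.Product.Base using (_×_; _,_; ∃-syntax; proj₁; proj₂)
open import Data.Sum.Base using (_⊎_; inj₁; inj₂)
open import Data.Vec.Base using (Vec; []; _∷_; lookup; zipWith)
import Data.Vec.Properties as Vec
open import Function.Base using (_∘_; id)
open import Function.Definitions using (Injective)
open import Relation.Binary.PropositionalEquality
open import Relation.Nullary using (¬_; Dec; yes; no; contradiction; does)
open import Relation.Nullary.Decidable using (_×-dec_; ¬?; dec-true)

open import Algebra.Properties.Semiring.Sum ℕ.+-*-semiring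
  using (sum; ∑-distrib-+; ∑-comm; sum-permute; sum-cong-≗; *-distribˡ-sum; *-distribʳ-sum)
open import Algebra.Properties.Semiring.Sum ℤ.+-*-semiring using () renaming
  ( sum to sumℤ; ∑-distrib-+ to sumℤ-distrib-+; ∑-comm to sumℤ-comm; sum-permute to sumℤ-permute
  ; sum-cong-≗ to sumℤ-cong; *-distribˡ-sum to *-distribˡ-sumℤ; *-distribʳ-sum to *-distribʳ-sumℤ )

-- Injective self-maps of a finite set

injective⇒surjective : ∀ {n} {f : Fin n → Fin n} → Injective _≡_ _≡_ f → ∀ y → ∃[ x ] f x ≡ y
injective⇒surjective {zero}  _ ()
injective⇒surjective {suc n} {f} inj y with Fin.any? (λ x → f x Fin.≟ y)
... | yes hit  = hit
-- A missed value `y` can be punched out of the codomain, which would inject `Fin (suc n)` into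
-- `Fin n`.
... | no  miss = ⊥-elim (ℕ.1+n≰n (Fin.injective⇒≤ {f = g} g-inj))
  where
  y≢f : ∀ x → y ≢ f x
  y≢f x eq = miss (x , sym eq)
  g : Fin (suc n) → Fin n
  g x = punchOut (y≢f x)
  g-inj : Injective _≡_ _≡_ g
  g-inj {x} {x'} eq = inj (Fin.punchOut-injective (y≢f x) (y≢f x') eq)

injective⇒permutation : ∀ {n} {f : Fin n → Fin n} → Injective _≡_ _≡_ f → Perm.Permutation n n
injective⇒permutation {f = f} inj =
  Perm.permutation f (proj₁ ∘ sur) (proj₂ ∘ sur) (λ x → inj (proj₂ (sur (f x))))
  where sur = injective⇒surjective inj

-- The field 𝔽ₚ

module Modular (p : ℕ) {{nz : NonZero p}} where

  private
    mod-≡ : ∀ {m n} → m % p ≡ n % p → m mod p ≡ n mod p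
    mod-≡ eq = Fin.fromℕ<-cong _ _ eq _ _

    toℕ-mod : ∀ m → toℕ (m mod p) ≡ m % p
    toℕ-mod m = Fin.toℕ-fromℕ< (m%n<n m p)

    mod-toℕ : ∀ (a : Fin p) → toℕ a mod p ≡ a
    mod-toℕ a = Fin.toℕ-injective (trans (toℕ-mod (toℕ a)) (m<n⇒m%n≡m (Fin.toℕ<n a)))

  mod-+ : ∀ m n → (m + n) mod p ≡ m mod p +ₚ n mod p
  mod-+ m n = mod-≡ (trans (%-distribˡ-+ m n p)
    (cong (_% p) (sym (cong₂ _+_ (toℕ-mod m) (toℕ-mod n)))))

  mod-* : ∀ m n → (m * n) mod p ≡ (m mod p) *ₚ (n mod p)
  mod-* m n = mod-≡ (trans (%-distribˡ-* m n p)
    (cong (_% p) (sym (cong₂ _*_ (toℕ-mod m) (toℕ-mod n)))))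

  mod-+ˡ : ∀ m (a : Fin p) → m mod p +ₚ a ≡ (m + toℕ a) mod p
  mod-+ˡ m a = sym (trans (mod-+ m (toℕ a)) (cong (m mod p +ₚ_) (mod-toℕ a)))

  mod-+ʳ : ∀ (a : Fin p) m → a +ₚ m mod p ≡ (toℕ a + m) mod p
  mod-+ʳ a m = sym (trans (mod-+ (toℕ a) m) (cong (_+ₚ m mod p) (mod-toℕ a)))

  mod-*ˡ : ∀ m (a : Fin p) → (m mod p) *ₚ a ≡ (m * toℕ a) mod p
  mod-*ˡ m a = sym (trans (mod-* m (toℕ a)) (cong ((m mod p) *ₚ_) (mod-toℕ a)))

  mod-*ʳ : ∀ (a : Fin p) m → a *ₚ (m mod p) ≡ (toℕ a * m) mod p
  mod-*ʳ a m = sym (trans (mod-* (toℕ a) m) (cong (_*ₚ (m mod p)) (mod-toℕ a)))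

  0ₚ 1ₚ : Fin p
  0ₚ = 0 mod p
  1ₚ = 1 mod p

  -ₚ_ : Fin p → Fin p
  -ₚ a = (p ∸ toℕ a) mod p

  private
    +-comm : ∀ (a b : Fin p) → a +ₚ b ≡ b +ₚ a
    +-comm a b = cong (_mod p) (ℕ.+-comm (toℕ a) (toℕ b))

    *-comm : ∀ (a b : Fin p) → a *ₚ b ≡ b *ₚ a
    *-comm a b = cong (_mod p) (ℕ.*-comm (toℕ a) (toℕ b))

    +-assoc : ∀ (a b c : Fin p) → (a +ₚ b) +ₚ c ≡ a +ₚ (b +ₚ c)
    +-assoc a b c = trans (mod-+ˡ _ c)
      (trans (cong (_mod p) (ℕ.+-assoc (toℕ a) (toℕ b) (toℕ c))) (sym (mod-+ʳ a _)))

    *-assoc : ∀ (a b c : Fin p) → (a *ₚ b) *ₚ c ≡ a *ₚ (b *ₚ c)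
    *-assoc a b c = trans (mod-*ˡ _ c)
      (trans (cong (_mod p) (ℕ.*-assoc (toℕ a) (toℕ b) (toℕ c))) (sym (mod-*ʳ a _)))

    +-identityˡ : ∀ (a : Fin p) → 0ₚ +ₚ a ≡ a
    +-identityˡ a = trans (mod-+ˡ 0 a) (mod-toℕ a)

    *-identityˡ : ∀ (a : Fin p) → 1ₚ *ₚ a ≡ a
    *-identityˡ a = trans (mod-*ˡ 1 a) (trans (cong (_mod p) (ℕ.+-identityʳ (toℕ a))) (mod-toℕ a))

    -ₚ-inverseˡ : ∀ (a : Fin p) → (-ₚ a) +ₚ a ≡ 0ₚ
    -ₚ-inverseˡ a = trans (mod-+ˡ _ a) (mod-≡ (trans
      (cong (_% p) (ℕ.m∸n+n≡m (ℕ.<⇒≤ (Fin.toℕ<n a)))) (trans (n%n≡0 p) (sym (0%p≡0)))))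
      where
      0%p≡0 : 0 % p ≡ 0
      0%p≡0 = m*n%n≡0 0 p

    *-distribˡ : ∀ (a b c : Fin p) → a *ₚ (b +ₚ c) ≡ a *ₚ b +ₚ a *ₚ c
    *-distribˡ a b c = trans (mod-*ʳ a _)
      (trans (cong (_mod p) (ℕ.*-distribˡ-+ (toℕ a) (toℕ b) (toℕ c))) (mod-+ _ _))

    *-distribʳ : ∀ (a b c : Fin p) → (b +ₚ c) *ₚ a ≡ b *ₚ a +ₚ c *ₚ a
    *-distribʳ a b c = trans (*-comm _ a)
      (trans (*-distribˡ a b c) (cong₂ _+ₚ_ (*-comm a b) (*-comm a c)))

  isCommutativeRingₚ : IsCommutativeRing _≡_ _+ₚ_ _*ₚ_ -ₚ_ 0ₚ 1ₚ
  isCommutativeRingₚ = record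
    { isRing = record
      { +-isAbelianGroup = record
        { isGroup = record
          { isMonoid = record
            { isSemigroup = record
              { isMagma = record { isEquivalence = isEquivalence ; ∙-cong = cong₂ _+ₚ_ }
              ; assoc = +-assoc }
            ; identity = +-identityˡ , λ a → trans (+-comm a 0ₚ) (+-identityˡ a) }
          ; inverse = -ₚ-inverseˡ , λ a → trans (+-comm a (-ₚ a)) (-ₚ-inverseˡ a)
          ; ⁻¹-cong = cong -ₚ_ }
        ; comm = +-comm }
      ; *-cong = cong₂ _*ₚ_
      ; *-assoc = *-assoc
      ; *-identity = *-identityˡ , λ a → trans (*-comm a 1ₚ) (*-identityˡ a)
      ; distrib = *-distribˡ , *-distribʳ }
    ; *-comm = *-comm }

  commutativeRingₚ : CommutativeRing _ _
  commutativeRingₚ = record { isCommutativeRing = isCommutativeRingₚ }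

  mod-0 : ∀ {m} → m mod p ≡ 0ₚ → p ∣ m
  mod-0 {m} eq = m%n≡0⇒n∣m m p (trans (sym (toℕ-mod m)) (trans (cong toℕ eq)
    (trans (toℕ-mod 0) (m*n%n≡0 0 p))))

  ∣toℕ⇒≡0 : ∀ (a : Fin p) → p ∣ toℕ a → a ≡ 0ₚ
  ∣toℕ⇒≡0 a p∣a with toℕ a in eq
  ... | zero  = trans (sym (mod-toℕ a)) (cong (_mod p) eq)
  ... | suc m = contradiction (ℕ.≤-<-trans (∣⇒≤ p∣a) (subst (_< p) eq (Fin.toℕ<n a))) (ℕ.<-irrefl refl)

module PrimeField (p : ℕ) (pr : Prime p) where

  instance
    p≢0 : NonZero p
    p≢0 = prime⇒nonZero pr

  open Modular p public
  open CommutativeRing commutativeRingₚ public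
    using (_-_; ring; +-abelianGroup; +-group)
    renaming (+-assoc to +ₚ-assoc; +-comm to +ₚ-comm; +-identityˡ to +ₚ-identityˡ)
  open import Algebra.Properties.Group +-group public using
    ( ∙-cancelʳ ; ∙-cancelˡ; x∙y⁻¹≈ε⇒x≈y; x≈y⇒x∙y⁻¹≈ε)
    renaming (//-rightDividesˡ to x-y+y≡x; //-rightDividesʳ to x+y-y≡x)
  open import Algebra.Properties.AbelianGroup +-abelianGroup public using (⁻¹-∙-comm)
  open import Algebra.Properties.CommutativeSemigroup
    (CommutativeRing.+-commutativeSemigroup commutativeRingₚ) public using () renaming (interchange to +ₚ-medial)
  open import Algebra.Properties.Ring ring public using (x[y-z]≈xy-xz; [y-z]x≈yx-zx)

  *ₚ-noZeroDivisors : ∀ a b → a *ₚ b ≡ 0ₚ → a ≡ 0ₚ ⊎ b ≡ 0ₚ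
  *ₚ-noZeroDivisors a b eq with euclidsLemma (toℕ a) (toℕ b) pr (mod-0 eq)
  ... | inj₁ p∣a = inj₁ (∣toℕ⇒≡0 a p∣a)
  ... | inj₂ p∣b = inj₂ (∣toℕ⇒≡0 b p∣b)

  *ₚ-cancelʳ : ∀ d → d ≢ 0ₚ → ∀ {a b} → a *ₚ d ≡ b *ₚ d → a ≡ b
  *ₚ-cancelʳ d d≢0 {a} {b} eq with *ₚ-noZeroDivisors (a - b) d
    (trans ([y-z]x≈yx-zx d a b) (x≈y⇒x∙y⁻¹≈ε eq))
  ... | inj₁ a-b≡0 = x∙y⁻¹≈ε⇒x≈y a b a-b≡0
  ... | inj₂ d≡0   = contradiction d≡0 d≢0

  +ₚ-injectiveʳ : ∀ c → Injective _≡_ _≡_ (_+ₚ c)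
  +ₚ-injectiveʳ c = ∙-cancelʳ c _ _

  -- The multiples of a nonzero `d` run through all of 𝔽ₚ. Both Cauchy-Davenport and the vanishing
  -- of off-diagonal correlations rest on this.
  affine-injective : ∀ {d} c → d ≢ 0ₚ → Injective _≡_ _≡_ (λ x → c +ₚ x *ₚ d)
  affine-injective {d} c d≢0 {x} {x'} eq = *ₚ-cancelʳ d d≢0 (∙-cancelˡ c _ _ eq)

  -ₚ-interchange : ∀ a b c d → (a +ₚ b) - (c +ₚ d) ≡ (a - c) +ₚ (b - d)
  -ₚ-interchange a b c d = trans (cong (a +ₚ b +ₚ_) (sym (⁻¹-∙-comm c d))) (+ₚ-medial a b _ _)

-- Sums and cardinalities over Fin n

does⇒ : ∀ {a} {P : Set a} (P? : Dec P) → does P? ≡ true → P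
does⇒ (yes p) _ = p

sum-reindex : ∀ {n} (f : Fin n → ℕ) {σ : Fin n → Fin n} → Injective _≡_ _≡_ σ → sum (f ∘ σ) ≡ sum f
sum-reindex f inj = sym (sum-permute f (injective⇒permutation inj))

sum-mono : ∀ {n} {f g : Fin n → ℕ} → (∀ i → f i ≤ g i) → sum f ≤ sum g
sum-mono {zero}  f≤g = z≤n
sum-mono {suc n} f≤g = ℕ.+-mono-≤ (f≤g zero) (sum-mono (f≤g ∘ suc))

sum-const : ∀ n c → sum {n} (λ _ → c) ≡ n * c
sum-const zero    c = refl
sum-const (suc n) c = cong (_+_ c) (sum-const n c)

⟦_⟧ : Bool → ℕ
⟦ true  ⟧ = 1
⟦ false ⟧ = 0

⟦⟧≤1 : ∀ a → ⟦ a ⟧ ≤ 1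
⟦⟧≤1 true  = ℕ.≤-refl
⟦⟧≤1 false = z≤n

⟦⟧-mono : ∀ {a b} → (a ≡ true → b ≡ true) → ⟦ a ⟧ ≤ ⟦ b ⟧
⟦⟧-mono {false} _ = z≤n
⟦⟧-mono {true}  f rewrite f refl = ℕ.≤-refl

⟦∧⟧ : ∀ a b → ⟦ a ∧ b ⟧ ≡ ⟦ a ⟧ * ⟦ b ⟧
⟦∧⟧ true  b = sym (ℕ.+-identityʳ ⟦ b ⟧)
⟦∧⟧ false b = refl

⟦∨⟧+⟦∧⟧ : ∀ a b → ⟦ a ∨ b ⟧ + ⟦ b ∧ a ⟧ ≡ ⟦ a ⟧ + ⟦ b ⟧
⟦∨⟧+⟦∧⟧ true  true  = refl
⟦∨⟧+⟦∧⟧ true  false = refl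
⟦∨⟧+⟦∧⟧ false true  = refl
⟦∨⟧+⟦∧⟧ false false = refl

∧-true⁻ : ∀ {a b} → a ∧ b ≡ true → a ≡ true × b ≡ true
∧-true⁻ {true} {true} _ = refl , refl

∨-true⁻ : ∀ {a b} → a ∨ b ≡ true → a ≡ true ⊎ b ≡ true
∨-true⁻ {true}  _  = inj₁ refl
∨-true⁻ {false} eq = inj₂ eq

card : ∀ {n} → (Fin n → Bool) → ℕ
card χ = sum (λ i → ⟦ χ i ⟧)

card-lookup : ∀ {n} (S : Subset n) → ∣ S ∣ ≡ card (lookup S)
card-lookup []            = refl
card-lookup (inside ∷ S)  = cong suc (card-lookup S)
card-lookup (outside ∷ S) = card-lookup S

card-mono : ∀ {n} {χ ψ : Fin n → Bool} → (∀ i → χ i ≡ true → ψ i ≡ true) → card χ ≤ card ψ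
card-mono sub = sum-mono (λ i → ⟦⟧-mono (sub i))

card-strict : ∀ {n} {χ ψ : Fin n → Bool} → (∀ i → χ i ≡ true → ψ i ≡ true) →
              ∀ i → χ i ≡ false → ψ i ≡ true → card χ < card ψ
card-strict {χ = χ} sub zero χi ψi rewrite χi | ψi = s≤s (card-mono (sub ∘ suc))
card-strict sub (suc i) χi ψi = ℕ.+-mono-≤-< (⟦⟧-mono (sub zero)) (card-strict (sub ∘ suc) i χi ψi)

card-true : ∀ {n} {χ : Fin n → Bool} → (∀ i → χ i ≡ true) → card χ ≡ n
card-true {n} all = trans (sum-cong-≗ (cong ⟦_⟧ ∘ all)) (trans (sum-const n 1) (ℕ.*-identityʳ n))

card≤ : ∀ {n} (χ : Fin n → Bool) → card χ ≤ n
card≤ {n} χ = subst (card χ ≤_) (card-true {χ = λ _ → true} (λ _ → refl)) (card-mono {χ = χ} (λ _ _ → refl))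

card-pos : ∀ {n} {χ : Fin n → Bool} i → χ i ≡ true → 1 ≤ card χ
card-pos {χ = χ} zero    χi rewrite χi = s≤s z≤n
card-pos {χ = χ} (suc i) χi = ℕ.≤-trans (card-pos i χi) (ℕ.m≤n+m _ ⟦ χ zero ⟧)

card-pos⁻ : ∀ {n} {χ : Fin n → Bool} → 1 ≤ card χ → ∃[ i ] χ i ≡ true
card-pos⁻ {suc n} {χ} pos with χ zero in eq
... | true  = zero , eq
... | false with card-pos⁻ pos
...   | i , χi = suc i , χi

card-subsingleton : ∀ {n} {χ : Fin n → Bool} j → (∀ i → χ i ≡ true → i ≡ j) → card χ ≤ 1
card-subsingleton {suc n} {χ} zero only =
  subst (λ c → ⟦ χ zero ⟧ + c ≤ 1) (sym none) (subst (_≤ 1) (sym (ℕ.+-identityʳ _)) (⟦⟧≤1 (χ zero)))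
  where
  none : card (χ ∘ suc) ≡ 0
  none with card (χ ∘ suc) in eq
  ... | zero  = refl
  ... | suc _ with card-pos⁻ (subst (1 ≤_) (sym eq) (s≤s z≤n))
  ...   | i , χi with () ← only (suc i) χi
card-subsingleton {suc n} {χ} (suc j) only with χ zero in eq
... | true  with () ← only zero eq
... | false = card-subsingleton j (λ i χi → Fin.suc-injective (only (suc i) χi))

-- Sumsets in 𝔽ₚ

module Sumsets (p : ℕ) (pr : Prime p) where

  open PrimeField p pr
  open import Algebra.Properties.Group +-group using (⁻¹-injective)
  open import Algebra.Properties.AbelianGroup +-abelianGroup using (⁻¹-anti-homo‿-)

  x-[y-z] : ∀ x y z → x - (y - z) ≡ z +ₚ (x - y)
  x-[y-z] x y z = trans (cong (x +ₚ_) (⁻¹-anti-homo‿- y z))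
    (trans (sym (+ₚ-assoc x z (-ₚ y))) (trans (cong (_- y) (+ₚ-comm x z)) (+ₚ-assoc z x (-ₚ y))))

  x-[x-z] : ∀ x z → x - (x - z) ≡ z
  x-[x-z] x z = trans (x-[y-z] x x z) (trans (sym (+ₚ-assoc z x (-ₚ x))) (x+y-y≡x x z))

  x+y-x≡y : ∀ x y → (x +ₚ y) - x ≡ y
  x+y-x≡y x y = trans (cong (_- x) (+ₚ-comm x y)) (x+y-y≡x x y)

  y+x-y≡x : ∀ y x → y +ₚ (x - y) ≡ x
  y+x-y≡x y x = trans (+ₚ-comm y (x - y)) (x-y+y≡x y x)

  card-translate : ∀ χ c → card (λ x → χ (x +ₚ c)) ≡ card χ
  card-translate χ c = sum-reindex (⟦_⟧ ∘ χ) (+ₚ-injectiveʳ c)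

  -- Repeated translation by `d` leads from `a` to every `a + t d`, and these exhaust 𝔽ₚ since `d`
  -- is nonzero.
  invariant⇒all : ∀ (χ : Fin p → Bool) {d} → d ≢ 0ₚ → (∀ x → χ x ≡ true → χ (x +ₚ d) ≡ true) →
                  ∀ {a} → χ a ≡ true → ∀ x → χ x ≡ true
  invariant⇒all χ {d} d≢0 closed {a} χa x with injective⇒surjective (affine-injective a d≢0) x
  ... | t , refl = multiples (toℕ t)
    where
    multiples : ∀ k → χ (a +ₚ (k * toℕ d) mod p) ≡ true
    multiples zero    = subst (λ y → χ y ≡ true) (sym (trans (+ₚ-comm a 0ₚ) (+ₚ-identityˡ a))) χa
    multiples (suc k) = subst (λ y → χ y ≡ true) step (closed _ (multiples k))
      where
      step : (a +ₚ (k * toℕ d) mod p) +ₚ d ≡ a +ₚ (suc k * toℕ d) mod p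
      step = trans (+ₚ-assoc a _ d) (cong (a +ₚ_)
        (trans (mod-+ˡ _ d) (cong (_mod p) (ℕ.+-comm (k * toℕ d) (toℕ d)))))

  -- Dyson's e-transform (A , B) ↦ (A ∪ (B - c) , B ∩ (A + c)) keeps |A| + |B| and sums inside S;
  -- it shrinks B unless A is invariant under a nonzero translation.
  cauchyDavenport-fuel : ∀ fuel (A B S : Fin p → Bool) → card B < fuel →
    ∀ {a b} → A a ≡ true → B b ≡ true →
    (∀ a b → A a ≡ true → B b ≡ true → S (a +ₚ b) ≡ true) →
    p ≤ card S ⊎ card A + card B ≤ suc (card S)
  cauchyDavenport-fuel zero A B S () _ _ _
  cauchyDavenport-fuel (suc fuel) A B S (s≤s |B|≤fuel) {a₀} {b₀} Aa₀ Bb₀ A+B⊆S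
    -- `A (b₀ - c)` keeps `b₀` in the new second set B ∩ (A + c), while the element `b` with `b - c`
    -- outside `A` drops out of it, so the recursion is on a smaller nonempty set.
    with Fin.any? (λ c → Fin.any? (λ b →
           (A (b₀ - c) Bool.≟ true) ×-dec (B b Bool.≟ true) ×-dec (A (b - c) Bool.≟ false)))
  ... | yes (c , b , Ab₀-c , Bb , ¬Ab-c) = result
    where
    A' B' : Fin p → Bool
    A' x = A x ∨ B (x +ₚ c)
    B' x = B x ∧ A (x - c)

    |B'|≡ : card B' ≡ card (λ x → B (x +ₚ c) ∧ A x)
    |B'|≡ = trans (sym (card-translate B' c))
      (sum-cong-≗ (λ x → cong (λ y → ⟦ B (x +ₚ c) ∧ A y ⟧) (x+y-y≡x c x)))

    sizes : card A' + card B' ≡ card A + card B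
    sizes = begin
      card A' + card B'                                 ≡⟨ cong (_+_ (card A')) |B'|≡ ⟩
      card A' + card (λ x → B (x +ₚ c) ∧ A x)            ≡⟨ ∑-distrib-+ (⟦_⟧ ∘ A') (λ x → ⟦ B (x +ₚ c) ∧ A x ⟧) ⟨
      sum (λ x → ⟦ A' x ⟧ + ⟦ B (x +ₚ c) ∧ A x ⟧)        ≡⟨ sum-cong-≗ (λ x → ⟦∨⟧+⟦∧⟧ (A x) _) ⟩
      sum (λ x → ⟦ A x ⟧ + ⟦ B (x +ₚ c) ⟧)               ≡⟨ ∑-distrib-+ (⟦_⟧ ∘ A) (λ x → ⟦ B (x +ₚ c) ⟧) ⟩
      card A + card (λ x → B (x +ₚ c))                   ≡⟨ cong (_+_ (card A)) (card-translate B c) ⟩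
      card A + card B                                   ∎
      where open ≡-Reasoning

    |B'|<|B| : card B' < card B
    |B'|<|B| = card-strict {χ = B'} (λ _ → proj₁ ∘ ∧-true⁻) b
      (trans (cong (B b ∧_) ¬Ab-c) (Bool.∧-zeroʳ (B b))) Bb

    A'+B'⊆S : ∀ x y → A' x ≡ true → B' y ≡ true → S (x +ₚ y) ≡ true
    A'+B'⊆S x y A'x B'y with ∧-true⁻ {B y} B'y | ∨-true⁻ {A x} A'x
    ... | By , _   | inj₁ Ax = A+B⊆S x y Ax By
    ... | _ , Ay-c | inj₂ Bx+c = subst (λ z → S z ≡ true) eq (A+B⊆S _ _ Ay-c Bx+c)
      where
      eq : (y - c) +ₚ (x +ₚ c) ≡ x +ₚ y
      eq = trans (cong ((y - c) +ₚ_) (+ₚ-comm x c))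
        (trans (sym (+ₚ-assoc (y - c) c x)) (trans (cong (_+ₚ x) (x-y+y≡x c y)) (+ₚ-comm y x)))

    result : p ≤ card S ⊎ card A + card B ≤ suc (card S)
    result = subst (λ k → p ≤ card S ⊎ k ≤ suc (card S)) sizes
      (cauchyDavenport-fuel fuel A' B' S (ℕ.<-≤-trans |B'|<|B| |B|≤fuel) {a₀} {b₀}
        (cong (_∨ B (a₀ +ₚ c)) Aa₀) (cong₂ _∧_ Bb₀ Ab₀-c) A'+B'⊆S)
  -- Without such a `c`, taking `c = b₀ - x` for `x` in `A` shows A + (b - b₀) ⊆ A for every `b` in
  -- `B`. So a second element of `B` forces `A` to be all of 𝔽ₚ.
  ... | no none with Fin.any? (λ b → (B b Bool.≟ true) ×-dec ¬? (b Fin.≟ b₀))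
  ...   | yes (b , Bb , b≢b₀) = inj₁ (ℕ.≤-reflexive (sym (card-true S-full)))
    where
    closed : ∀ x → A x ≡ true → A (x +ₚ (b - b₀)) ≡ true
    closed x Ax with A (x +ₚ (b - b₀)) in eq
    ... | true  = refl
    ... | false = ⊥-elim (none (b₀ - x , b , trans (cong A (x-[x-z] b₀ x)) Ax , Bb ,
                    trans (cong A (x-[y-z] b b₀ x)) eq))

    S-full : ∀ x → S x ≡ true
    S-full x = subst (λ y → S y ≡ true) (x-y+y≡x b₀ x)
      (A+B⊆S _ _ (invariant⇒all A (b≢b₀ ∘ x∙y⁻¹≈ε⇒x≈y b b₀) closed Aa₀ (x - b₀)) Bb₀)
  ...   | no ¬b = inj₂ (begin
    card A + card B                   ≤⟨ ℕ.+-mono-≤ |A|≤|S| |B|≤1 ⟩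
    card S + 1                        ≡⟨ ℕ.+-comm _ 1 ⟩
    suc (card S)                      ∎)
    where
    open ℕ.≤-Reasoning
    |B|≤1 : card B ≤ 1
    |B|≤1 = card-subsingleton b₀ only
      where
      only : ∀ b → B b ≡ true → b ≡ b₀
      only b Bb with b Fin.≟ b₀
      ... | yes eq = eq
      ... | no neq = ⊥-elim (¬b (b , Bb , neq))
    |A|≤|S| : card A ≤ card S
    |A|≤|S| = subst (card A ≤_) (card-translate S b₀) (card-mono (λ x Ax → A+B⊆S x b₀ Ax Bb₀))

  cauchyDavenport : ∀ (A B S : Fin p → Bool) → ∀ {a b} → A a ≡ true → B b ≡ true →
    (∀ a b → A a ≡ true → B b ≡ true → S (a +ₚ b) ≡ true) →
    p ≤ card S ⊎ card A + card B ≤ suc (card S)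
  cauchyDavenport A B S = cauchyDavenport-fuel (suc (card B)) A B S (ℕ.n<1+n _)

  -- Representation counts, sumset growth and popular sums

  fibre : (Fin p → Bool) → Fin p → Fin p → Bool
  fibre X u x = X x ∧ X (u - x)

  r : (Fin p → Bool) → Fin p → ℕ
  r X u = card (fibre X u)

  sum-r : ∀ X → sum (r X) ≡ card X * card X
  sum-r X = begin
    sum (λ u → sum (λ x → ⟦ X x ∧ X (u - x) ⟧))          ≡⟨ ∑-comm (λ u x → ⟦ X x ∧ X (u - x) ⟧) ⟩
    sum (λ x → sum (λ u → ⟦ X x ∧ X (u - x) ⟧))          ≡⟨ sum-cong-≗ inner ⟩
    sum (λ x → ⟦ X x ⟧ * card X)                         ≡⟨ *-distribʳ-sum (card X) (⟦_⟧ ∘ X) ⟨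
    card X * card X                                      ∎
    where
    open ≡-Reasoning
    inner : ∀ x → sum (λ u → ⟦ X x ∧ X (u - x) ⟧) ≡ ⟦ X x ⟧ * card X
    inner x = begin
      sum (λ u → ⟦ X x ∧ X (u - x) ⟧)      ≡⟨ sum-cong-≗ (λ u → ⟦∧⟧ (X x) (X (u - x))) ⟩
      sum (λ u → ⟦ X x ⟧ * ⟦ X (u - x) ⟧)  ≡⟨ *-distribˡ-sum ⟦ X x ⟧ (λ u → ⟦ X (u - x) ⟧) ⟨
      ⟦ X x ⟧ * card (λ u → X (u - x))     ≡⟨ cong (⟦ X x ⟧ *_) (card-translate X (-ₚ x)) ⟩
      ⟦ X x ⟧ * card X                     ∎

  r≤card : ∀ X u → r X u ≤ card X
  r≤card X u = card-mono {χ = fibre X u} (λ _ → proj₁ ∘ ∧-true⁻)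

  -- Inclusion-exclusion: X and u - X have the same size and meet exactly in the fibre over `u`.
  2card≤p+r : ∀ X u → card X + card X ≤ p + r X u
  2card≤p+r X u = begin
    card X + card X                               ≡⟨ cong (_+_ (card X)) reflect ⟨
    card X + card (λ x → X (u - x))                ≡⟨ ∑-distrib-+ (⟦_⟧ ∘ X) (λ x → ⟦ X (u - x) ⟧) ⟨
    sum (λ x → ⟦ X x ⟧ + ⟦ X (u - x) ⟧)            ≤⟨ sum-mono (λ x → pointwise (X x) (X (u - x))) ⟩
    sum (λ x → 1 + ⟦ fibre X u x ⟧)                ≡⟨ ∑-distrib-+ (λ _ → 1) (⟦_⟧ ∘ fibre X u) ⟩
    sum {p} (λ _ → 1) + r X u                     ≡⟨ cong (_+ r X u) (trans (sum-const p 1) (ℕ.*-identityʳ p)) ⟩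
    p + r X u                                     ∎
    where
    open ℕ.≤-Reasoning
    reflect : card (λ x → X (u - x)) ≡ card X
    reflect = sum-reindex (⟦_⟧ ∘ X) (λ eq → ⁻¹-injective (∙-cancelˡ u _ _ eq))
    pointwise : ∀ a b → ⟦ a ⟧ + ⟦ b ⟧ ≤ 1 + ⟦ a ∧ b ⟧
    pointwise true  b = ℕ.≤-refl
    pointwise false b = ⟦⟧≤1 b

  -- X + X as the support of `r X`, so that membership directly yields a pair of summands.
  sumset : (Fin p → Bool) → Fin p → Bool
  sumset X u = does (1 ℕ.≤? r X u)

  sumset-+ : ∀ X a b → X a ≡ true → X b ≡ true → sumset X (a +ₚ b) ≡ true
  sumset-+ X a b Xa Xb = dec-true (1 ℕ.≤? r X (a +ₚ b))
    (card-pos {χ = fibre X (a +ₚ b)} a (cong₂ _∧_ Xa (trans (cong X (x+y-x≡y a b)) Xb)))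

  card≤sumset : ∀ X {a} → X a ≡ true → card X ≤ card (sumset X)
  card≤sumset X {a} Xa = subst (card X ≤_) (card-translate (sumset X) a)
    (card-mono (λ x Xx → sumset-+ X x a Xx Xa))

  -- Cauchy-Davenport gives |X + X| ≥ min(p, 2q - 1) with q = |X|. If p is the minimum, the sparsity
  -- hypothesis is the claim; otherwise (2 + s) q ≤ (1 + s)(2q - 1) amounts to 1 + s ≤ s q, which
  -- follows from q ≥ 2 and s ≥ 1.
  sumset-growth : ∀ s X → 1 ≤ s → 2 ≤ card X → (2 + s) * card X ≤ (1 + s) * p →
                  (2 + s) * card X ≤ (1 + s) * card (sumset X)
  sumset-growth s X 1≤s 2≤q sparse with card-pos⁻ {χ = X} (ℕ.≤-trans (ℕ.n≤1+n 1) 2≤q)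
  ... | a , Xa with cauchyDavenport X X (sumset X) Xa Xa (sumset-+ X)
  ...   | inj₁ full = ℕ.≤-trans sparse (ℕ.*-monoʳ-≤ (1 + s) full)
  ...   | inj₂ big  = ℕ.+-cancelˡ-≤ (1 + s) _ _ (begin
    (1 + s) + (2 + s) * q             ≤⟨ ℕ.+-monoˡ-≤ _ (ℕ.+-monoˡ-≤ s 1≤s) ⟩
    (s + s) + (2 + s) * q             ≡⟨ e₁ s q ⟩
    s * 2 + (2 + s) * q               ≤⟨ ℕ.+-monoˡ-≤ _ (ℕ.*-monoʳ-≤ s 2≤q) ⟩
    s * q + (2 + s) * q               ≡⟨ e₂ s q ⟩
    (1 + s) * (q + q)                 ≤⟨ ℕ.*-monoʳ-≤ (1 + s) big ⟩
    (1 + s) * suc (card (sumset X))   ≡⟨ ℕ.*-suc (1 + s) _ ⟩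
    (1 + s) + (1 + s) * card (sumset X) ∎)
    where
    open ℕ.≤-Reasoning
    q = card X
    e₁ : ∀ s q → (s + s) + (2 + s) * q ≡ s * 2 + (2 + s) * q
    e₁ = solve-∀
    e₂ : ∀ s q → s * q + (2 + s) * q ≡ (1 + s) * (q + q)
    e₂ = solve-∀

  -- The count `r X u` is at least the fraction s/(1 + s) of its average |X|²/p over all `u`.
  Popular : ℕ → (Fin p → Bool) → Fin p → Set
  Popular s X u = s * (card X * card X) ≤ (1 + s) * p * r X u

  popular? : ∀ s X u → Dec (Popular s X u)
  popular? s X u = s * (card X * card X) ℕ.≤? (1 + s) * p * r X u

  popular : ℕ → (Fin p → Bool) → Fin p → Bool
  popular s X u = does (popular? s X u)

  -- The counts add up to |X|². Unpopular `u` account for at most s/(1 + s) of this, and each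
  -- popular `u` for at most |X|, so at least |X|/(1 + s) of them are popular.
  card≤popular : ∀ s X {a} → X a ≡ true → card X ≤ (1 + s) * card (popular s X)
  card≤popular s X Xa = ℕ.*-cancelˡ-≤ (p * q) (ℕ.+-cancelʳ-≤ (p * (s * (q * q))) _ _ (begin
    p * q * q + p * (s * (q * q))                  ≡⟨ e₁ p q s ⟩
    (1 + s) * p * (q * q)                          ≡⟨ cong ((1 + s) * p *_) (sum-r X) ⟨
    (1 + s) * p * sum (r X)                        ≡⟨ *-distribˡ-sum ((1 + s) * p) (r X) ⟩
    sum (λ u → (1 + s) * p * r X u)                ≤⟨ sum-mono pointwise ⟩
    sum (λ u → ⟦ popular s X u ⟧ * ((1 + s) * p * q) + s * (q * q))
      ≡⟨ ∑-distrib-+ (λ u → ⟦ popular s X u ⟧ * ((1 + s) * p * q)) _ ⟩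
    sum (λ u → ⟦ popular s X u ⟧ * ((1 + s) * p * q)) + sum {p} (λ _ → s * (q * q))
      ≡⟨ cong₂ _+_ (*-distribʳ-sum ((1 + s) * p * q) (⟦_⟧ ∘ popular s X)) (sym (sum-const p _)) ⟨
    N * ((1 + s) * p * q) + p * (s * (q * q))      ≡⟨ e₂ p q s N ⟩
    p * q * ((1 + s) * N) + p * (s * (q * q))      ∎))
    where
    open ℕ.≤-Reasoning
    q = card X
    N = card (popular s X)
    instance
      pq≢0 : NonZero (p * q)
      pq≢0 = ℕ.m*n≢0 p q {{p≢0}} {{ℕ.>-nonZero (card-pos {χ = X} _ Xa)}}
    e₁ : ∀ p q s → p * q * q + p * (s * (q * q)) ≡ (1 + s) * p * (q * q)
    e₁ = solve-∀
    e₂ : ∀ p q s N → N * ((1 + s) * p * q) + p * (s * (q * q)) ≡ p * q * ((1 + s) * N) + p * (s * (q * q))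
    e₂ = solve-∀
    pointwise : ∀ u → (1 + s) * p * r X u ≤ ⟦ popular s X u ⟧ * ((1 + s) * p * q) + s * (q * q)
    pointwise u with popular? s X u
    ... | yes pop rewrite dec-true (popular? s X u) pop = ℕ.≤-trans (ℕ.*-monoʳ-≤ ((1 + s) * p) (r≤card X u))
                    (ℕ.≤-trans (ℕ.≤-reflexive (sym (ℕ.*-identityˡ _))) (ℕ.m≤m+n _ _))
    ... | no ¬pop = ℕ.≤-trans (ℕ.<⇒≤ (ℕ.≰⇒> ¬pop)) (ℕ.m≤n+m _ _)

  dense⇒popular : ∀ s X → (1 + s) * p < (2 + s) * card X → ∀ u → Popular s X u
  dense⇒popular s X dense u = subst (λ P → s * (q * q) ≤ (1 + s) * P * r X u) (ℕ.m+[n∸m]≡n (card≤ X)) goal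
    where
    open ℕ.≤-Reasoning
    q = card X
    -- `m` is the size of the complement, and `t` = q - m = 2q - p is the lower bound for `r X u`
    -- from `2card≤p+r`. Density says (1 + s) m < q, hence s m ≤ t.
    m = p ∸ q
    p≡ : p ≡ q + m
    p≡ = sym (ℕ.m+[n∸m]≡n (card≤ X))
    e₁ : ∀ s q m → (1 + s) * (q + m) ≡ (1 + s) * q + (m + s * m)
    e₁ = solve-∀
    e₂ : ∀ s q → (2 + s) * q ≡ (1 + s) * q + q
    e₂ = solve-∀
    small : m + s * m < q
    small = ℕ.+-cancelˡ-< ((1 + s) * q) _ _
      (subst₂ _<_ (trans (cong ((1 + s) *_) p≡) (e₁ s q m)) (e₂ s q) dense)
    t = q ∸ m
    q≡ : q ≡ m + t
    q≡ = sym (ℕ.m+[n∸m]≡n (ℕ.≤-trans (ℕ.m≤m+n m _) (ℕ.<⇒≤ small)))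
    sm≤t : s * m ≤ t
    sm≤t = ℕ.<⇒≤ (ℕ.+-cancelˡ-< m _ _ (subst (m + s * m <_) q≡ small))
    t≤r : t ≤ r X u
    t≤r = ℕ.+-cancelˡ-≤ m _ _ (ℕ.+-cancelˡ-≤ q _ _ (begin
      q + (m + t)      ≡⟨ cong (_+_ q) q≡ ⟨
      q + q            ≤⟨ 2card≤p+r X u ⟩
      p + r X u        ≡⟨ cong (_+ r X u) p≡ ⟩
      q + m + r X u    ≡⟨ ℕ.+-assoc q m _ ⟩
      q + (m + r X u)  ∎))
    e₃ : ∀ s m t → s * ((m + t) * (m + t)) ≡ s * m * m + s * (2 * m * t + t * t)
    e₃ = solve-∀
    e₄ : ∀ s m t → t * m + (t * m + t * t) + s * (2 * m * t + t * t) ≡ (1 + s) * ((m + t) + m) * t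
    e₄ = solve-∀
    goal : s * (q * q) ≤ (1 + s) * (q + m) * r X u
    goal = begin
      s * (q * q)                                           ≡⟨ cong (λ y → s * (y * y)) q≡ ⟩
      s * ((m + t) * (m + t))                               ≡⟨ e₃ s m t ⟩
      s * m * m + s * (2 * m * t + t * t)                   ≤⟨ ℕ.+-monoˡ-≤ _ (ℕ.*-monoˡ-≤ m sm≤t) ⟩
      t * m + s * (2 * m * t + t * t)                       ≤⟨ ℕ.+-monoˡ-≤ (s * (2 * m * t + t * t)) (ℕ.m≤m+n (t * m) _) ⟩
      t * m + (t * m + t * t) + s * (2 * m * t + t * t)     ≡⟨ e₄ s m t ⟩
      (1 + s) * ((m + t) + m) * t                           ≡⟨ cong (λ y → (1 + s) * (y + m) * t) q≡ ⟨
      (1 + s) * (q + m) * t                                 ≤⟨ ℕ.*-monoʳ-≤ ((1 + s) * (q + m)) t≤r ⟩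
      (1 + s) * (q + m) * r X u                             ∎

-- Integer sums and Cauchy–Schwarz

+-sum : ∀ {n} (f : Fin n → ℕ) → + sum f ≡ sumℤ (+_ ∘ f)
+-sum {zero}  f = refl
+-sum {suc n} f = cong (ℤ._+_ (+ f zero)) (+-sum (f ∘ suc))

sumℤ-reindex : ∀ {n} (f : Fin n → ℤ) {σ : Fin n → Fin n} → Injective _≡_ _≡_ σ → sumℤ (f ∘ σ) ≡ sumℤ f
sumℤ-reindex f inj = sym (sumℤ-permute f (injective⇒permutation inj))

sumℤ-const : ∀ n c → sumℤ {n} (λ _ → c) ≡ + n ℤ.* c
sumℤ-const zero    c = sym (ℤ.*-zeroˡ c)
sumℤ-const (suc n) c = trans (cong (ℤ._+_ c) (sumℤ-const n c)) (sym (ℤ.suc-* (+ n) c))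

sumℤ-mono : ∀ {n} {f g : Fin n → ℤ} → (∀ i → f i ℤ.≤ g i) → sumℤ f ℤ.≤ sumℤ g
sumℤ-mono {zero}  f≤g = ℤ.≤-refl
sumℤ-mono {suc n} f≤g = ℤ.+-mono-≤ (f≤g zero) (sumℤ-mono (f≤g ∘ suc))

sumℤ-zero : ∀ {n} {f : Fin n → ℤ} → (∀ i → f i ≡ 0ℤ) → sumℤ f ≡ 0ℤ
sumℤ-zero {n} f≡0 = trans (sumℤ-cong f≡0) (trans (sumℤ-const n 0ℤ) (ℤ.*-zeroʳ (+ n)))

sumℤ-single : ∀ {n} {f : Fin n → ℤ} i → (∀ j → j ≢ i → f j ≡ 0ℤ) → sumℤ f ≡ f i
sumℤ-single {f = f} zero    vanish =
  trans (cong (ℤ._+_ (f zero)) (sumℤ-zero (λ j → vanish (suc j) (λ ())))) (ℤ.+-identityʳ (f zero))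
sumℤ-single {f = f} (suc i) vanish =
  trans (cong₂ ℤ._+_ (vanish zero (λ ())) (sumℤ-single {f = f ∘ suc} i (λ j j≢i → vanish (suc j) (j≢i ∘ Fin.suc-injective))))
    (ℤ.+-identityˡ _)

sumℤ-nonneg : ∀ {n} {f : Fin n → ℤ} → (∀ i → 0ℤ ℤ.≤ f i) → 0ℤ ℤ.≤ sumℤ f
sumℤ-nonneg {zero}  f≥0 = ℤ.≤-refl
sumℤ-nonneg {suc n} f≥0 = ℤ.+-mono-≤ (f≥0 zero) (sumℤ-nonneg (f≥0 ∘ suc))

term≤sumℤ : ∀ {n} {f : Fin n → ℤ} → (∀ j → 0ℤ ℤ.≤ f j) → ∀ i → f i ℤ.≤ sumℤ f
term≤sumℤ {f = f} f≥0 zero    = subst (ℤ._≤ sumℤ f) (ℤ.+-identityʳ (f zero))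
  (ℤ.+-monoʳ-≤ (f zero) (sumℤ-nonneg (f≥0 ∘ suc)))
term≤sumℤ {f = f} f≥0 (suc i) = subst (ℤ._≤ sumℤ f) (ℤ.+-identityˡ (f (suc i)))
  (ℤ.+-mono-≤ (f≥0 zero) (term≤sumℤ (f≥0 ∘ suc) i))

sum*sum : ∀ {m n} (f : Fin m → ℤ) (g : Fin n → ℤ) → sumℤ f ℤ.* sumℤ g ≡ sumℤ (λ i → sumℤ (λ j → f i ℤ.* g j))
sum*sum f g = trans (*-distribʳ-sumℤ (sumℤ g) f) (sumℤ-cong (λ i → *-distribˡ-sumℤ (f i) g))

0≤square : ∀ x → 0ℤ ℤ.≤ x ℤ.* x
0≤square (+ n)      = subst (0ℤ ℤ.≤_) (ℤ.pos-* n n) (ℤ.+≤+ ℕ.z≤n)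
0≤square ℤ.-[1+ n ] = ℤ.+≤+ ℕ.z≤n

2xy≤x²+y² : ∀ x y → + 2 ℤ.* (x ℤ.* y) ℤ.≤ x ℤ.* x ℤ.+ y ℤ.* y
2xy≤x²+y² x y = ℤ.0≤i-j⇒j≤i (subst (0ℤ ℤ.≤_) (expand x y) (0≤square (x ℤ.- y)))
  where
  expand : ∀ x y → (x ℤ.- y) ℤ.* (x ℤ.- y) ≡ x ℤ.* x ℤ.+ y ℤ.* y ℤ.- + 2 ℤ.* (x ℤ.* y)
  expand = ℤ-Solver.solve-∀

-- Both sides are doubled and expanded into double sums, which compare termwise by 2xy ≤ x² + y²
-- with x = aᵢ fⱼ and y = fᵢ aⱼ.
cauchySchwarz : ∀ {n} (a f : Fin n → ℤ) →
  sumℤ (λ i → a i ℤ.* f i) ℤ.* sumℤ (λ i → a i ℤ.* f i) ℤ.≤ sumℤ (λ i → a i ℤ.* a i) ℤ.* sumℤ (λ i → f i ℤ.* f i)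
cauchySchwarz {n} a f = ℤ.*-cancelˡ-≤-pos _ _ (+ 2) (begin
  + 2 ℤ.* (S ℤ.* S)                                               ≡⟨ cong (ℤ._*_ (+ 2)) (sum*sum af af) ⟩
  + 2 ℤ.* sumℤ (λ i → sumℤ (λ j → a i ℤ.* f i ℤ.* (a j ℤ.* f j)))       ≡⟨ push (λ i j → a i ℤ.* f i ℤ.* (a j ℤ.* f j)) ⟩
  sumℤ (λ i → sumℤ (λ j → + 2 ℤ.* (a i ℤ.* f i ℤ.* (a j ℤ.* f j))))     ≤⟨ sumℤ-mono (λ i → sumℤ-mono (λ j → amgm (a i) (f i) (a j) (f j))) ⟩
  sumℤ (λ i → sumℤ (λ j → a i ℤ.* a i ℤ.* (f j ℤ.* f j) ℤ.+ f i ℤ.* f i ℤ.* (a j ℤ.* a j)))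
    ≡⟨ sumℤ-cong (λ i → sumℤ-distrib-+ (λ j → a i ℤ.* a i ℤ.* (f j ℤ.* f j)) (λ j → f i ℤ.* f i ℤ.* (a j ℤ.* a j))) ⟩
  sumℤ (λ i → sumℤ (λ j → a i ℤ.* a i ℤ.* (f j ℤ.* f j)) ℤ.+ sumℤ (λ j → f i ℤ.* f i ℤ.* (a j ℤ.* a j)))
    ≡⟨ sumℤ-distrib-+ (λ i → sumℤ (λ j → a i ℤ.* a i ℤ.* (f j ℤ.* f j))) (λ i → sumℤ (λ j → f i ℤ.* f i ℤ.* (a j ℤ.* a j))) ⟩
  sumℤ (λ i → sumℤ (λ j → a i ℤ.* a i ℤ.* (f j ℤ.* f j))) ℤ.+ sumℤ (λ i → sumℤ (λ j → f i ℤ.* f i ℤ.* (a j ℤ.* a j)))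
    ≡⟨ cong₂ ℤ._+_ (sum*sum aa ff) (sum*sum ff aa) ⟨
  sumℤ aa ℤ.* sumℤ ff ℤ.+ sumℤ ff ℤ.* sumℤ aa                           ≡⟨ twice (sumℤ aa) (sumℤ ff) ⟩
  + 2 ℤ.* (sumℤ aa ℤ.* sumℤ ff)                                     ∎)
  where
  open ℤ.≤-Reasoning
  af aa ff : Fin n → ℤ
  af i = a i ℤ.* f i
  aa i = a i ℤ.* a i
  ff i = f i ℤ.* f i
  S = sumℤ af
  push : (g : Fin n → Fin n → ℤ) → + 2 ℤ.* sumℤ (λ i → sumℤ (g i)) ≡ sumℤ (λ i → sumℤ (λ j → + 2 ℤ.* g i j))
  push g = trans (*-distribˡ-sumℤ (+ 2) (λ i → sumℤ (g i))) (sumℤ-cong (λ i → *-distribˡ-sumℤ (+ 2) (g i)))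
  twice : ∀ x y → x ℤ.* y ℤ.+ y ℤ.* x ≡ + 2 ℤ.* (x ℤ.* y)
  twice = ℤ-Solver.solve-∀
  amgm : ∀ a f b g → + 2 ℤ.* (a ℤ.* f ℤ.* (b ℤ.* g)) ℤ.≤ a ℤ.* a ℤ.* (g ℤ.* g) ℤ.+ f ℤ.* f ℤ.* (b ℤ.* b)
  amgm a f b g = subst₂ ℤ._≤_ (e₁ a f b g) (e₂ a f b g) (2xy≤x²+y² (a ℤ.* g) (f ℤ.* b))
    where
    e₁ : ∀ a f b g → + 2 ℤ.* (a ℤ.* g ℤ.* (f ℤ.* b)) ≡ + 2 ℤ.* (a ℤ.* f ℤ.* (b ℤ.* g))
    e₁ = ℤ-Solver.solve-∀
    e₂ : ∀ a f b g → a ℤ.* g ℤ.* (a ℤ.* g) ℤ.+ f ℤ.* b ℤ.* (f ℤ.* b) ≡ a ℤ.* a ℤ.* (g ℤ.* g) ℤ.+ f ℤ.* f ℤ.* (b ℤ.* b)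
    e₂ = ℤ-Solver.solve-∀

ι : Bool → ℤ
ι b = + ⟦ b ⟧

ι-idem : ∀ b → ι b ℤ.* ι b ≡ ι b
ι-idem true  = refl
ι-idem false = refl

sum-ι : ∀ {n} (χ : Fin n → Bool) → sumℤ (ι ∘ χ) ≡ + card χ
sum-ι χ = sym (+-sum (⟦_⟧ ∘ χ))

energy : ∀ {n} → (Fin n → ℤ) → ℤ
energy h = sumℤ (λ w → h w ℤ.* h w)

-- Variance of convolutions

module Variance (p : ℕ) (pr : Prime p) where

  open PrimeField p pr

  translate-sum : ∀ (h : Fin p → ℤ) c → sumℤ (λ w → h (w - c)) ≡ sumℤ h
  translate-sum h c = sumℤ-reindex h (+ₚ-injectiveʳ (-ₚ c))

  -- The point mass at 0, scaled by p and recentred to mean zero. It describes the empty sum, whose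
  -- only value is 0.
  spike : Fin p → ℤ
  spike w = ι (does (w Fin.≟ 0ₚ)) ℤ.* + p ℤ.+ -1ℤ

  private
    sum-ι₀ : ∀ c → sumℤ (λ w → ι (does (w Fin.≟ 0ₚ)) ℤ.* c) ≡ c
    sum-ι₀ c = trans (sumℤ-single {f = λ w → ι (does (w Fin.≟ 0ₚ)) ℤ.* c} 0ₚ off) on
      where
      off : ∀ w → w ≢ 0ₚ → ι (does (w Fin.≟ 0ₚ)) ℤ.* c ≡ 0ℤ
      off w w≢0 with w Fin.≟ 0ₚ
      ... | yes eq = contradiction eq w≢0
      ... | no  _  = ℤ.*-zeroˡ c
      on : ι (does (0ₚ Fin.≟ 0ₚ)) ℤ.* c ≡ c
      on with 0ₚ Fin.≟ 0ₚ
      ... | yes _  = ℤ.*-identityˡ c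
      ... | no neq = contradiction refl neq

  sum-spike : sumℤ spike ≡ 0ℤ
  sum-spike = trans (sumℤ-distrib-+ (λ w → ι (does (w Fin.≟ 0ₚ)) ℤ.* + p) (λ _ → -1ℤ))
    (trans (cong₂ ℤ._+_ (sum-ι₀ (+ p)) (sumℤ-const p -1ℤ)) (cancel (+ p)))
    where
    cancel : ∀ x → x ℤ.+ x ℤ.* -1ℤ ≡ 0ℤ
    cancel = ℤ-Solver.solve-∀

  -- The energy is exactly p² - p.
  energy-spike : energy spike ℤ.≤ + p ℤ.* + p
  energy-spike = ℤ.0≤i-j⇒j≤i (subst (0ℤ ℤ.≤_) (sym gap) (ℤ.+≤+ ℕ.z≤n))
    where
    square : ∀ b x → (ι b ℤ.* x ℤ.+ -1ℤ) ℤ.* (ι b ℤ.* x ℤ.+ -1ℤ) ≡ ι b ℤ.* (x ℤ.* x ℤ.+ ℤ.- (+ 2 ℤ.* x)) ℤ.+ 1ℤ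
    square true  = s₁
      where
      s₁ : ∀ x → (1ℤ ℤ.* x ℤ.+ -1ℤ) ℤ.* (1ℤ ℤ.* x ℤ.+ -1ℤ) ≡ 1ℤ ℤ.* (x ℤ.* x ℤ.+ ℤ.- (+ 2 ℤ.* x)) ℤ.+ 1ℤ
      s₁ = ℤ-Solver.solve-∀
    square false = s₀
      where
      s₀ : ∀ x → (0ℤ ℤ.* x ℤ.+ -1ℤ) ℤ.* (0ℤ ℤ.* x ℤ.+ -1ℤ) ≡ 0ℤ ℤ.* (x ℤ.* x ℤ.+ ℤ.- (+ 2 ℤ.* x)) ℤ.+ 1ℤ
      s₀ = ℤ-Solver.solve-∀
    P = + p
    total : energy spike ≡ (P ℤ.* P ℤ.+ ℤ.- (+ 2 ℤ.* P)) ℤ.+ P ℤ.* 1ℤ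
    total = trans (sumℤ-cong (λ w → square (does (w Fin.≟ 0ₚ)) P))
      (trans (sumℤ-distrib-+ (λ w → ι (does (w Fin.≟ 0ₚ)) ℤ.* (P ℤ.* P ℤ.+ ℤ.- (+ 2 ℤ.* P))) (λ _ → 1ℤ))
        (cong₂ ℤ._+_ (sum-ι₀ _) (sumℤ-const p 1ℤ)))
    simplify : ∀ x → x ℤ.* x ℤ.- ((x ℤ.* x ℤ.+ ℤ.- (+ 2 ℤ.* x)) ℤ.+ x ℤ.* 1ℤ) ≡ x
    simplify = ℤ-Solver.solve-∀
    gap : P ℤ.* P ℤ.- energy spike ≡ P
    gap = trans (cong (λ e → P ℤ.* P ℤ.- e) total) (simplify P)

  module Convolution (A C : Fin p → Bool) (φ : Fin p → Fin p) where

    -- The contribution of one coordinate to the central component; `φ` stands for the carry as a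
    -- function of `y`.
    shift : Fin p → Fin p → Fin p
    shift x y = x *ₚ y +ₚ φ y

    module _ (h : Fin p → ℤ) where

      inner : Fin p → Fin p → ℤ
      inner w x = sumℤ (λ y → ι (C y) ℤ.* h (w - shift x y))

      convolve : Fin p → ℤ
      convolve w = sumℤ (λ x → ι (A x) ℤ.* inner w x)

      -- Applied with `c` = -T: if every choice in the new coordinate leads to a missed value, then
      -- `w` is missed too, and its deviation is again minus the number of choices.
      convolve-const : ∀ w c → (∀ x y → A x ≡ true → C y ≡ true → h (w - shift x y) ≡ c) →
                       convolve w ≡ + (card A ℕ.* card C) ℤ.* c
      convolve-const w c const = begin
        sumℤ (λ x → ι (A x) ℤ.* inner w x)                 ≡⟨ sumℤ-cong (λ x → guard (A x) (inner-const x)) ⟩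
        sumℤ (λ x → ι (A x) ℤ.* (+ card C ℤ.* c))            ≡⟨ *-distribʳ-sumℤ (+ card C ℤ.* c) (ι ∘ A) ⟨
        sumℤ (ι ∘ A) ℤ.* (+ card C ℤ.* c)                    ≡⟨ cong (ℤ._* (+ card C ℤ.* c)) (sum-ι A) ⟩
        + card A ℤ.* (+ card C ℤ.* c)                       ≡⟨ ℤ.*-assoc (+ card A) (+ card C) c ⟨
        + card A ℤ.* + card C ℤ.* c                         ≡⟨ cong (ℤ._* c) (ℤ.pos-* (card A) (card C)) ⟨
        + (card A ℕ.* card C) ℤ.* c                       ∎
        where
        open ≡-Reasoning
        guard : ∀ b {i j} → (b ≡ true → i ≡ j) → ι b ℤ.* i ≡ ι b ℤ.* j
        guard true  eq = cong (1ℤ ℤ.*_) (eq refl)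
        guard false {i} {j} _  = trans (ℤ.*-zeroˡ i) (sym (ℤ.*-zeroˡ j))
        inner-const : ∀ x → A x ≡ true → inner w x ≡ + card C ℤ.* c
        inner-const x Ax = trans (sumℤ-cong (λ y → guard (C y) (const x y Ax)))
          (trans (sym (*-distribʳ-sumℤ c (ι ∘ C))) (cong (ℤ._* c) (sum-ι C)))

      module _ (mean0 : sumℤ h ≡ 0ℤ) where

        sum-convolve : sumℤ convolve ≡ 0ℤ
        sum-convolve = begin
          sumℤ (λ w → sumℤ (λ x → ι (A x) ℤ.* inner w x))   ≡⟨ sumℤ-comm (λ w x → ι (A x) ℤ.* inner w x) ⟩
          sumℤ (λ x → sumℤ (λ w → ι (A x) ℤ.* inner w x))   ≡⟨ sumℤ-zero (λ x → trans
            (sym (*-distribˡ-sumℤ (ι (A x)) (λ w → inner w x)))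
            (trans (cong (ι (A x) ℤ.*_) (sum-inner x)) (ℤ.*-zeroʳ (ι (A x))))) ⟩
          0ℤ                                            ∎
          where
          open ≡-Reasoning
          sum-inner : ∀ x → sumℤ (λ w → inner w x) ≡ 0ℤ
          sum-inner x = trans (sumℤ-comm (λ w y → ι (C y) ℤ.* h (w - shift x y))) (sumℤ-zero (λ y → trans
            (sym (*-distribˡ-sumℤ (ι (C y)) (λ w → h (w - shift x y))))
            (trans (cong (ι (C y) ℤ.*_) (trans (translate-sum h (shift x y)) mean0)) (ℤ.*-zeroʳ (ι (C y))))))

        -- Here `x` ranges over all of 𝔽ₚ, not just `A`. Completing the sum in this way is what
        -- makes the off-diagonal terms cancel.
        correlation : Fin p → Fin p → ℤ
        correlation y y' = sumℤ (λ w → sumℤ (λ x → h (w - shift x y) ℤ.* h (w - shift x y')))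

        correlation-diag : ∀ y → correlation y y ≡ + p ℤ.* energy h
        correlation-diag y = begin
          correlation y y                                                ≡⟨ sumℤ-comm (λ w x → h (w - shift x y) ℤ.* h (w - shift x y)) ⟩
          sumℤ (λ x → sumℤ (λ w → h (w - shift x y) ℤ.* h (w - shift x y)))  ≡⟨ sumℤ-cong (λ x → translate-sum (λ w → h w ℤ.* h w) (shift x y)) ⟩
          sumℤ {p} (λ _ → energy h)                                       ≡⟨ sumℤ-const p (energy h) ⟩
          + p ℤ.* energy h                                                 ∎
          where open ≡-Reasoning

        -- For y ≢ y' the difference of the two shifts runs through all residues as x varies.
        correlation-off : ∀ y y' → y ≢ y' → correlation y y' ≡ 0ℤ
        correlation-off y y' y≢y' = begin
          correlation y y'
            ≡⟨ sumℤ-comm (λ w x → h (w - shift x y) ℤ.* h (w - shift x y')) ⟩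
          sumℤ (λ x → sumℤ (λ w → h (w - shift x y) ℤ.* h (w - shift x y')))
            -- Replacing `w` by `w + shift x y` leaves `x` only in the second factor, through the
            -- multiple x (y - y').
            ≡⟨ sumℤ-cong (λ x → sumℤ-reindex (λ w → h (w - shift x y) ℤ.* h (w - shift x y')) (+ₚ-injectiveʳ (shift x y))) ⟨
          sumℤ (λ x → sumℤ (λ w → h ((w +ₚ shift x y) - shift x y) ℤ.* h ((w +ₚ shift x y) - shift x y')))
            ≡⟨ sumℤ-cong (λ x → sumℤ-cong (λ w → cong₂ (λ a b → h a ℤ.* h b) (x+y-y≡x (shift x y) w) (affine w x))) ⟩
          sumℤ (λ x → sumℤ (λ w → h w ℤ.* h (w +ₚ (φ y - φ y') +ₚ x *ₚ (y - y'))))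
            ≡⟨ sumℤ-comm (λ x w → h w ℤ.* h (w +ₚ (φ y - φ y') +ₚ x *ₚ (y - y'))) ⟩
          sumℤ (λ w → sumℤ (λ x → h w ℤ.* h (w +ₚ (φ y - φ y') +ₚ x *ₚ (y - y'))))
            ≡⟨ sumℤ-zero (λ w → trans (sym (*-distribˡ-sumℤ (h w) (λ x → h (w +ₚ (φ y - φ y') +ₚ x *ₚ (y - y')))))
                 (trans (cong (h w ℤ.*_) (trans (sumℤ-reindex h (affine-injective (w +ₚ (φ y - φ y')) d≢0)) mean0))
                   (ℤ.*-zeroʳ (h w)))) ⟩
          0ℤ ∎
          where
          open ≡-Reasoning
          d≢0 : y - y' ≢ 0ₚ
          d≢0 = y≢y' ∘ x∙y⁻¹≈ε⇒x≈y y y'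
          affine : ∀ w x → (w +ₚ shift x y) - shift x y' ≡ w +ₚ (φ y - φ y') +ₚ x *ₚ (y - y')
          affine w x = begin
            (w +ₚ shift x y) - shift x y'                     ≡⟨ +ₚ-assoc w _ _ ⟩
            w +ₚ (shift x y - shift x y')                     ≡⟨ cong (w +ₚ_) (-ₚ-interchange (x *ₚ y) (φ y) (x *ₚ y') (φ y')) ⟩
            w +ₚ ((x *ₚ y - x *ₚ y') +ₚ (φ y - φ y'))          ≡⟨ cong (w +ₚ_) (+ₚ-comm (x *ₚ y - x *ₚ y') (φ y - φ y')) ⟩
            w +ₚ ((φ y - φ y') +ₚ (x *ₚ y - x *ₚ y'))          ≡⟨ +ₚ-assoc w _ _ ⟨
            w +ₚ (φ y - φ y') +ₚ (x *ₚ y - x *ₚ y')            ≡⟨ cong (w +ₚ (φ y - φ y') +ₚ_) (x[y-z]≈xy-xz x y y') ⟨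
            w +ₚ (φ y - φ y') +ₚ x *ₚ (y - y')                 ∎

        -- Expanding the square gives correlations of pairs from `C`, and only the |C| diagonal ones
        -- survive.
        sum-inner² : sumℤ (λ w → sumℤ (λ x → inner w x ℤ.* inner w x)) ≡ + card C ℤ.* (+ p ℤ.* energy h)
        sum-inner² = begin
          sumℤ (λ w → sumℤ (λ x → inner w x ℤ.* inner w x))
            ≡⟨ sumℤ-cong (λ w → sumℤ-cong (λ x → trans (sum*sum (term w x) (term w x))
                 (sumℤ-cong (λ y → sumℤ-cong (λ y' → regroup (ι (C y)) (h (w - shift x y)) (ι (C y')) (h (w - shift x y'))))))) ⟩
          sumℤ (λ w → sumℤ (λ x → sumℤ (λ y → sumℤ (λ y' → t w x y y'))))
            ≡⟨ sumℤ-cong (λ w → sumℤ-comm (λ x y → sumℤ (λ y' → t w x y y'))) ⟩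
          sumℤ (λ w → sumℤ (λ y → sumℤ (λ x → sumℤ (λ y' → t w x y y'))))
            ≡⟨ sumℤ-comm (λ w y → sumℤ (λ x → sumℤ (λ y' → t w x y y'))) ⟩
          sumℤ (λ y → sumℤ (λ w → sumℤ (λ x → sumℤ (λ y' → t w x y y'))))
            ≡⟨ sumℤ-cong (λ y → sumℤ-cong (λ w → sumℤ-comm (λ x y' → t w x y y'))) ⟩
          sumℤ (λ y → sumℤ (λ w → sumℤ (λ y' → sumℤ (λ x → t w x y y'))))
            ≡⟨ sumℤ-cong (λ y → sumℤ-comm (λ w y' → sumℤ (λ x → t w x y y'))) ⟩
          sumℤ (λ y → sumℤ (λ y' → sumℤ (λ w → sumℤ (λ x → t w x y y'))))
            ≡⟨ sumℤ-cong (λ y → sumℤ-cong (λ y' → sym (factor (ι (C y) ℤ.* ι (C y')) (λ w x → h (w - shift x y) ℤ.* h (w - shift x y'))))) ⟩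
          sumℤ (λ y → sumℤ (λ y' → ι (C y) ℤ.* ι (C y') ℤ.* correlation y y'))
            ≡⟨ sumℤ-cong diagonal ⟩
          sumℤ (λ y → ι (C y) ℤ.* (+ p ℤ.* energy h))
            ≡⟨ *-distribʳ-sumℤ (+ p ℤ.* energy h) (ι ∘ C) ⟨
          sumℤ (ι ∘ C) ℤ.* (+ p ℤ.* energy h)
            ≡⟨ cong (ℤ._* (+ p ℤ.* energy h)) (sum-ι C) ⟩
          + card C ℤ.* (+ p ℤ.* energy h) ∎
          where
          open ≡-Reasoning
          term : Fin p → Fin p → Fin p → ℤ
          term w x y = ι (C y) ℤ.* h (w - shift x y)
          t : Fin p → Fin p → Fin p → Fin p → ℤ
          t w x y y' = ι (C y) ℤ.* ι (C y') ℤ.* (h (w - shift x y) ℤ.* h (w - shift x y'))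
          regroup : ∀ a b c d → a ℤ.* b ℤ.* (c ℤ.* d) ≡ a ℤ.* c ℤ.* (b ℤ.* d)
          regroup = ℤ-Solver.solve-∀
          factor : ∀ c (g : Fin p → Fin p → ℤ) → c ℤ.* sumℤ (λ w → sumℤ (g w)) ≡ sumℤ (λ w → sumℤ (λ x → c ℤ.* g w x))
          factor c g = trans (*-distribˡ-sumℤ c (λ w → sumℤ (g w))) (sumℤ-cong (λ w → *-distribˡ-sumℤ c (g w)))
          diagonal : ∀ y → sumℤ (λ y' → ι (C y) ℤ.* ι (C y') ℤ.* correlation y y') ≡ ι (C y) ℤ.* (+ p ℤ.* energy h)
          diagonal y = trans
            (sumℤ-single {f = λ y' → ι (C y) ℤ.* ι (C y') ℤ.* correlation y y'} y
              (λ y' y'≢y → trans (cong (ι (C y) ℤ.* ι (C y') ℤ.*_) (correlation-off y y' (y'≢y ∘ sym)))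
                (ℤ.*-zeroʳ (ι (C y) ℤ.* ι (C y')))))
            (cong₂ ℤ._*_ (ι-idem (C y)) (correlation-diag y))

        -- Cauchy-Schwarz in `x` against the indicator of `A` costs a factor |A| and frees `x` to
        -- range over all of 𝔽ₚ; `sum-inner²` evaluates what remains.
        energy-convolve : energy convolve ℤ.≤ + (p ℕ.* (card A ℕ.* card C)) ℤ.* energy h
        energy-convolve = begin
          energy convolve
            ≤⟨ sumℤ-mono (λ w → cauchySchwarz (ι ∘ A) (inner w)) ⟩
          sumℤ (λ w → sumℤ (λ x → ι (A x) ℤ.* ι (A x)) ℤ.* sumℤ (λ x → inner w x ℤ.* inner w x))
            ≡⟨ *-distribˡ-sumℤ (sumℤ (λ x → ι (A x) ℤ.* ι (A x))) (λ w → sumℤ (λ x → inner w x ℤ.* inner w x)) ⟨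
          sumℤ (λ x → ι (A x) ℤ.* ι (A x)) ℤ.* sumℤ (λ w → sumℤ (λ x → inner w x ℤ.* inner w x))
            ≡⟨ cong₂ ℤ._*_ (trans (sumℤ-cong (ι-idem ∘ A)) (sum-ι A)) sum-inner² ⟩
          + card A ℤ.* (+ card C ℤ.* (+ p ℤ.* energy h))
            ≡⟨ regroup (+ card A) (+ card C) (+ p) (energy h) ⟩
          + p ℤ.* (+ card A ℤ.* + card C) ℤ.* energy h
            ≡⟨ cong (ℤ._* energy h) (trans (ℤ.pos-* p _) (cong (ℤ._*_ (+ p)) (ℤ.pos-* (card A) (card C)))) ⟨
          + (p ℕ.* (card A ℕ.* card C)) ℤ.* energy h ∎
          where
          open ℤ.≤-Reasoning
          regroup : ∀ a c p e → a ℤ.* (c ℤ.* (p ℤ.* e)) ≡ p ℤ.* (a ℤ.* c) ℤ.* e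
          regroup = ℤ-Solver.solve-∀

-- Filling a coset through rich coordinates

^-distribʳ-* : ∀ n x y → (x * y) ^ n ≡ x ^ n * y ^ n
^-distribʳ-* zero    x y = refl
^-distribʳ-* (suc n) x y =
  trans (cong (x * y *_) (^-distribʳ-* n x y)) (ℕ.[m*n]*[o*p]≡[m*o]*[n*p] x y (x ^ n) (y ^ n))

-- Serves to search the summands of a coordinate: either some choice reaches the target, or every
-- choice is certified to miss it.
either-all : ∀ {n} {P : Set} {Q : Fin n → Set} → (∀ i → P ⊎ Q i) → P ⊎ (∀ i → Q i)
either-all {zero}  f = inj₂ λ ()
either-all {suc n} {Q = Q} f with f zero | either-all (f ∘ suc)
... | inj₁ p | _      = inj₁ p
... | inj₂ q | inj₁ p = inj₁ p
... | inj₂ q | inj₂ qs = inj₂ λ { zero → q ; (suc i) → qs i }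

_∈ᵛ_ : ∀ {p n} → Vec (Fin p) n → Vec (Subset p) n → Set
x ∈ᵛ X = ∀ i → lookup x i ∈ lookup X i

∈ᵛ-cons : ∀ {p n} {X : Subset p} {Xs : Vec (Subset p) n} {x xs} →
          lookup X x ≡ true → xs ∈ᵛ Xs → (x ∷ xs) ∈ᵛ (X ∷ Xs)
∈ᵛ-cons {X = X} {x = x} Xx xs∈ zero    = Vec.lookup⇒[]= x X Xx
∈ᵛ-cons          Xx xs∈ (suc i) = xs∈ i

module Cosets (p : ℕ) (pr : Prime p) (E : ℕ) where

  open PrimeField p pr
  open Sumsets p pr
  open Variance p pr

  Represented : Subset p → Fin p → Set
  Represented X u = 1 ≤ r (lookup X) u

  Rich : Subset p → Subset p → Fin p → Fin p → Set
  Rich X Y u v = p ^ suc E ≤ (r (lookup X) u * r (lookup Y) v) ^ E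

  -- The index counts the coordinates whose summands will vary. A skipped coordinate needs just one
  -- representation, which is then frozen.
  data Selected : ℕ → ∀ {n} → (X Y : Vec (Subset p) n) (u v : Vec (Fin p) n) → Set where
    []   : Selected 0 [] [] [] []
    rich : ∀ {j n X Y u v} {Xs Ys : Vec (Subset p) n} {us vs} → Rich X Y u v →
           Selected j Xs Ys us vs → Selected (suc j) (X ∷ Xs) (Y ∷ Ys) (u ∷ us) (v ∷ vs)
    skip : ∀ {j n X Y u v} {Xs Ys : Vec (Subset p) n} {us vs} → Represented X u → Represented Y v →
           Selected j Xs Ys us vs → Selected j (X ∷ Xs) (Y ∷ Ys) (u ∷ us) (v ∷ vs)

  -- `value` is the central component of [x, y, 0] · [x', y', 0], a product lying over (u, v).
  record Reach {n} (X Y : Vec (Subset p) n) (u v : Vec (Fin p) n) (w : Fin p) : Set where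
    field
      x x' y y' : Vec (Fin p) n
      x∈  : x ∈ᵛ X
      x'∈ : x' ∈ᵛ X
      y∈  : y ∈ᵛ Y
      y'∈ : y' ∈ᵛ Y
      x+x'≡u : zipWith _+ₚ_ x x' ≡ u
      y+y'≡v : zipWith _+ₚ_ y y' ≡ v
      value  : dot x y' +ₚ carry y y' ≡ w

  -- `y` belongs to the second factor, so the first one has `v - y`; with `v` fixed the carry
  -- depends on `y` alone.
  carry₁ : Fin p → Fin p → Fin p
  carry₁ v y = ((toℕ (v - y) + toℕ y) / p) mod p

  extend : ∀ {n X Y u v x y} {Xs Ys : Vec (Subset p) n} {us vs} w →
    fibre (lookup X) u x ≡ true → fibre (lookup Y) v y ≡ true →
    Reach Xs Ys us vs (w - (x *ₚ y +ₚ carry₁ v y)) → Reach (X ∷ Xs) (Y ∷ Ys) (u ∷ us) (v ∷ vs) w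
  extend {X = X} {Y} {u} {v} {x} {y} w x-ok y-ok R with ∧-true⁻ {lookup X x} x-ok | ∧-true⁻ {lookup Y y} y-ok
  ... | Xx , Xu-x | Yy , Yv-y = record
    { x = x ∷ R.x ; x' = u - x ∷ R.x' ; y = v - y ∷ R.y ; y' = y ∷ R.y'
    ; x∈ = ∈ᵛ-cons Xx R.x∈ ; x'∈ = ∈ᵛ-cons Xu-x R.x'∈
    ; y∈ = ∈ᵛ-cons Yv-y R.y∈ ; y'∈ = ∈ᵛ-cons Yy R.y'∈
    ; x+x'≡u = cong₂ _∷_ (y+x-y≡x x u) R.x+x'≡u
    ; y+y'≡v = cong₂ _∷_ (x-y+y≡x y v) R.y+y'≡v
    ; value = trans (+ₚ-medial (x *ₚ y) (dot R.x R.y') (carry₁ v y) (carry R.y R.y'))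
                (trans (cong (x *ₚ y +ₚ carry₁ v y +ₚ_) R.value) (y+x-y≡x (x *ₚ y +ₚ carry₁ v y) w)) }
    where module R = Reach R

  -- T counts the choices of summands on the rich coordinates (fixed summands on the others);
  -- deviation w is p times the number of choices with value w, minus T.
  record Profile (j : ℕ) {n} (X Y : Vec (Subset p) n) (u v : Vec (Fin p) n) : Set where
    field
      deviation  : Fin p → ℤ
      T          : ℕ
      mean       : sumℤ deviation ≡ 0ℤ
      energy≤    : energy deviation ℤ.≤ + (p ^ (2 + j) * T)
      large      : p ^ (suc E * j) ≤ T ^ E
      reach      : ∀ w → Reach X Y u v w ⊎ deviation w ≡ ℤ.- (+ T)

  -- A rich coordinate with K choices multiplies the energy bound by p K and `T` by K, which
  -- preserves the shape p^(2 + j) T. A skipped coordinate only translates the deviation.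
  profile : ∀ {j n} {X Y : Vec (Subset p) n} {u v} → Selected j X Y u v → Profile j X Y u v
  profile [] = record
    { deviation = spike
    ; T       = 1
    ; mean    = sum-spike
    ; energy≤ = subst (energy spike ℤ.≤_) (trans (sym (ℤ.pos-* p p)) (cong +_ (e p))) energy-spike
    ; large   = ℕ.≤-reflexive (trans (cong (p ^_) (ℕ.*-zeroʳ (suc E))) (sym (ℕ.^-zeroˡ E)))
    ; reach   = start
    }
    where
    e : ∀ p → p * p ≡ p * (p * 1) * 1
    e = solve-∀
    start : ∀ w → Reach [] [] [] [] w ⊎ spike w ≡ ℤ.- (+ 1)
    start w with w Fin.≟ 0ₚ
    ... | no w≢0 = inj₂ refl
    ... | yes w≡0 = inj₁ (record
      { x = [] ; x' = [] ; y = [] ; y' = [] ; x∈ = λ () ; x'∈ = λ () ; y∈ = λ () ; y'∈ = λ ()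
      ; x+x'≡u = refl ; y+y'≡v = refl ; value = trans (+ₚ-identityˡ 0ₚ) (sym w≡0) })
  profile {suc j} (rich {X = X} {Y} {u} {v} {Xs} {Ys} {us} {vs} R sel) = record
    { deviation = convolve F.deviation
    ; T       = K * F.T
    ; mean    = sum-convolve F.deviation F.mean
    ; energy≤ = bound
    ; large   = begin
        p ^ (suc E * suc j)             ≡⟨ cong (p ^_) (ℕ.*-suc (suc E) j) ⟩
        p ^ (suc E + suc E * j)         ≡⟨ ℕ.^-distribˡ-+-* p (suc E) (suc E * j) ⟩
        p ^ suc E * p ^ (suc E * j)     ≤⟨ ℕ.*-mono-≤ R F.large ⟩
        K ^ E * F.T ^ E                 ≡⟨ ^-distribʳ-* E K F.T ⟨
        (K * F.T) ^ E                   ∎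
    ; reach   = next
    }
    where
    open ℕ.≤-Reasoning
    module F = Profile (profile sel)
    open Convolution (fibre (lookup X) u) (fibre (lookup Y) v) (carry₁ v)
    K = r (lookup X) u * r (lookup Y) v
    e : ∀ p q K T → p * K * (q * T) ≡ p * q * (K * T)
    e = solve-∀
    bound : energy (convolve F.deviation) ℤ.≤ + (p ^ (2 + suc j) * (K * F.T))
    bound = ℤ.≤-trans (energy-convolve F.deviation F.mean)
      (subst (+ (p * K) ℤ.* energy F.deviation ℤ.≤_)
        (trans (sym (ℤ.pos-* (p * K) _)) (cong +_ (e p (p ^ (2 + j)) K F.T)))
        (ℤ.*-monoˡ-≤-nonNeg (+ (p * K)) F.energy≤))
    next : ∀ w → Reach (X ∷ Xs) (Y ∷ Ys) (u ∷ us) (v ∷ vs) w ⊎ convolve F.deviation w ≡ ℤ.- (+ (K * F.T))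
    next w with either-all (λ x → either-all (λ y → try x y))
      where
      Missed : Fin p → Fin p → Set
      Missed x y = fibre (lookup X) u x ≡ true → fibre (lookup Y) v y ≡ true →
                   F.deviation (w - shift x y) ≡ ℤ.- (+ F.T)
      try : ∀ x y → Reach (X ∷ Xs) (Y ∷ Ys) (u ∷ us) (v ∷ vs) w ⊎ Missed x y
      try x y with fibre (lookup X) u x in eqx | fibre (lookup Y) v y in eqy
      ... | false | _     = inj₂ λ ()
      ... | true  | false = inj₂ λ _ ()
      ... | true  | true with F.reach (w - shift x y)
      ...   | inj₁ ok   = inj₁ (extend w eqx eqy ok)
      ...   | inj₂ miss = inj₂ λ _ _ → miss
    ... | inj₁ ok     = inj₁ ok
    ... | inj₂ missed = inj₂ (trans (convolve-const F.deviation w _ missed)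
            (trans (sym (ℤ.neg-distribʳ-* (+ K) (+ F.T))) (cong ℤ.-_ (sym (ℤ.pos-* K F.T)))))
  profile (skip {X = X} {Y} {u} {v} {Xs} {Ys} {us} {vs} u-rep v-rep sel)
    with card-pos⁻ {χ = fibre (lookup X) u} u-rep | card-pos⁻ {χ = fibre (lookup Y) v} v-rep
  ... | x , x-ok | y , y-ok = record
    { deviation = λ w → F.deviation (w - s)
    ; T       = F.T
    ; mean    = trans (translate-sum F.deviation s) F.mean
    ; energy≤ = subst (ℤ._≤ _) (sym (translate-sum (λ w → F.deviation w ℤ.* F.deviation w) s)) F.energy≤
    ; large   = F.large
    ; reach   = next
    }
    where
    module F = Profile (profile sel)
    s = x *ₚ y +ₚ carry₁ v y
    next : ∀ w → Reach (X ∷ Xs) (Y ∷ Ys) (u ∷ us) (v ∷ vs) w ⊎ F.deviation (w - s) ≡ ℤ.- (+ F.T)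
    next w with F.reach (w - s)
    ... | inj₁ ok   = inj₁ (extend w x-ok y-ok ok)
    ... | inj₂ miss = inj₂ miss

  1<p : 1 < p
  1<p = ℕ.nonTrivial⇒n>1 p {{prime⇒nonTrivial pr}}

  -- A missed `w` alone contributes T² to the energy, so T ≤ p^(2 + j). For j = 2E + 1 this
  -- contradicts T^E ≥ p^((E + 1) j), because (E + 1) j exceeds (2 + j) E by exactly 1.
  reachAll : ∀ {n} {X Y : Vec (Subset p) n} {u v} → Selected (suc (2 * E)) X Y u v → ∀ w → Reach X Y u v w
  reachAll {X = X} {Y} {u} {v} sel w with Profile.reach (profile sel) w
  ... | inj₁ ok   = ok
  ... | inj₂ miss = ⊥-elim (ℕ.<-irrefl refl (begin-strict
    T ^ E                         ≤⟨ ℕ.^-monoˡ-≤ E T≤ ⟩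
    (p ^ (2 + j)) ^ E             ≡⟨ ℕ.^-*-assoc p (2 + j) E ⟩
    p ^ ((2 + j) * E)             <⟨ ℕ.^-monoʳ-< p 1<p (ℕ.≤-reflexive (exponents E)) ⟩
    p ^ (suc E * j)               ≤⟨ large ⟩
    T ^ E                         ∎))
    where
    open ℕ.≤-Reasoning
    open Profile (profile sel)
    j = suc (2 * E)
    exponents : ∀ E → suc ((2 + suc (2 * E)) * E) ≡ suc E * suc (2 * E)
    exponents = solve-∀
    square : + (T * T) ≡ deviation w ℤ.* deviation w
    square = trans (ℤ.pos-* T T) (trans (sym (neg*neg (+ T))) (sym (cong₂ ℤ._*_ miss miss)))
      where
      neg*neg : ∀ i → (ℤ.- i) ℤ.* (ℤ.- i) ≡ i ℤ.* i
      neg*neg i = trans (sym (ℤ.neg-distribˡ-* i (ℤ.- i)))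
        (trans (cong ℤ.-_ (sym (ℤ.neg-distribʳ-* i i))) (ℤ.neg-involutive (i ℤ.* i)))
    T²≤ : T * T ≤ p ^ (2 + j) * T
    T²≤ = ℤ.drop‿+≤+ (subst (ℤ._≤ _) (sym square)
      (ℤ.≤-trans (term≤sumℤ {f = λ w → deviation w ℤ.* deviation w} (0≤square ∘ deviation) w) energy≤))
    T≤ : T ≤ p ^ (2 + j)
    T≤ = cancel T²≤
      where
      cancel : ∀ {t q} → t * t ≤ q * t → t ≤ q
      cancel {zero}  _  = z≤n
      cancel {suc t} le = ℕ.*-cancelʳ-≤ _ _ (suc t) le

  cosetIn : ∀ {n} (B : Brick p n) → Nonempty (Z B) → ∀ {u v} →
            Selected (suc (2 * E)) (X B) (Y B) u v → CosetIn B (u , v)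
  cosetIn B (z₀ , z₀∈Z) {u} {v} sel z =
    (x , y , z₀) , (x' , y' , z₀) , (x∈ , y∈ , z₀∈Z) , (x'∈ , y'∈ , z₀∈Z) ,
    cong₂ _,_ x+x'≡u (cong₂ _,_ y+y'≡v total)
    where
    -- The same `z₀` is used in both factors, so the other components must supply z - 2z₀.
    open Reach (reachAll sel (z - (z₀ +ₚ z₀)))
    total : z₀ +ₚ z₀ +ₚ dot x y' +ₚ carry y y' ≡ z
    total = trans (+ₚ-assoc (z₀ +ₚ z₀) (dot x y') (carry y y'))
      (trans (cong (z₀ +ₚ z₀ +ₚ_) value) (y+x-y≡x (z₀ +ₚ z₀) z))

-- Power inequalities

-- Bernoulli's inequality (1 + 1/G)^m ≥ 1 + m/G with denominators cleared.
bernoulli : ∀ G m → G ^ m * (G + m) ≤ (1 + G) ^ m * G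
bernoulli G zero    = ℕ.≤-reflexive (cong (_+ 0) (ℕ.+-identityʳ G))
bernoulli G (suc m) = begin
  G * G ^ m * (G + suc m)                  ≡⟨ e₁ G (G ^ m) m ⟩
  G ^ m * (G * (G + m) + G)                ≤⟨ ℕ.*-monoʳ-≤ (G ^ m) (ℕ.+-monoʳ-≤ (G * (G + m)) (ℕ.m≤m+n G m)) ⟩
  G ^ m * (G * (G + m) + (G + m))          ≡⟨ e₂ G (G ^ m) m ⟩
  (1 + G) * (G ^ m * (G + m))              ≤⟨ ℕ.*-monoʳ-≤ (1 + G) (bernoulli G m) ⟩
  (1 + G) * ((1 + G) ^ m * G)              ≡⟨ ℕ.*-assoc (1 + G) ((1 + G) ^ m) G ⟨
  (1 + G) * (1 + G) ^ m * G                ∎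
  where
  open ℕ.≤-Reasoning
  e₁ : ∀ G H m → G * H * (G + suc m) ≡ H * (G * (G + m) + G)
  e₁ = solve-∀
  e₂ : ∀ G H m → H * (G * (G + m) + (G + m)) ≡ (1 + G) * (H * (G + m))
  e₂ = solve-∀

-- Bernoulli with m = G t: that many gains by the factor (1 + G)/G make up for a loss by the factor
-- `t`.
growth-dominates : ∀ G t .{{_ : NonZero G}} → t * G ^ (G * t) ≤ (1 + G) ^ (G * t)
growth-dominates G t = ℕ.*-cancelʳ-≤ _ _ G (begin
  t * G ^ (G * t) * G           ≡⟨ e₁ t (G ^ (G * t)) G ⟩
  G ^ (G * t) * (G * t)         ≤⟨ ℕ.*-monoʳ-≤ (G ^ (G * t)) (ℕ.m≤n+m (G * t) G) ⟩
  G ^ (G * t) * (G + G * t)     ≤⟨ bernoulli G (G * t) ⟩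
  (1 + G) ^ (G * t) * G         ∎)
  where
  open ℕ.≤-Reasoning
  e₁ : ∀ t H G → t * H * G ≡ H * (G * t)
  e₁ = solve-∀

-- (1 + 1/s)^j ≤ 1 / (1 − j/s) for s = j + d.
power-ratio : ∀ j d → (1 + (j + d)) ^ j * d ≤ (j + d) ^ j * (j + d)
power-ratio zero    d = ℕ.≤-refl
power-ratio (suc j) d = begin
  (1 + s) * (1 + s) ^ j * d             ≡⟨ e₁ s ((1 + s) ^ j) d ⟩
  (1 + s) ^ j * (s * d + d)             ≤⟨ ℕ.*-monoʳ-≤ ((1 + s) ^ j) (ℕ.+-monoʳ-≤ (s * d) (ℕ.m≤n+m d (suc j))) ⟩
  (1 + s) ^ j * (s * d + s)             ≡⟨ e₂ s ((1 + s) ^ j) d ⟩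
  s * ((1 + s) ^ j * suc d)             ≤⟨ ℕ.*-monoʳ-≤ s (subst (λ s → (1 + s) ^ j * suc d ≤ s ^ j * s) (ℕ.+-suc j d) (power-ratio j (suc d))) ⟩
  s * (s ^ j * s)                       ≡⟨ ℕ.*-assoc s (s ^ j) s ⟨
  s * s ^ j * s                         ∎
  where
  open ℕ.≤-Reasoning
  s = suc j + d
  e₁ : ∀ s H d → (1 + s) * H * d ≡ H * (s * d + d)
  e₁ = solve-∀
  e₂ : ∀ s H d → H * (s * d + s) ≡ s * (H * suc d)
  e₂ = solve-∀

power-ratio-2 : ∀ j .{{_ : NonZero j}} → (1 + (j + j)) ^ j ≤ 2 * (j + j) ^ j
power-ratio-2 j = ℕ.*-cancelʳ-≤ _ _ j (ℕ.≤-trans (power-ratio j j) (ℕ.≤-reflexive (e ((j + j) ^ j) j)))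
  where
  e : ∀ H j → H * (j + j) ≡ 2 * H * j
  e = solve-∀

square^ : ∀ x c → (x * x) ^ c ≡ x ^ (c + c)
square^ x c = trans (^-distribʳ-* c x x) (sym (ℕ.^-distribˡ-+-* x c c))

-- In the application x, y are set sizes and u, v representation counts; with s = 2j the factor
-- ((1 + s) / s)^j is at most 2, hence is absorbed by a single factor p.
rich-bound : ∀ {p} c .{{_ : NonZero c}} (let j = c + c ; s = j + j) {d} → 2 ≤ p → 2 ≤ d → ∀ {x y u v} →
  p ^ (c + j + d) ≤ (x * y) ^ j →
  s * (x * x) ≤ (1 + s) * p * u → s * (y * y) ≤ (1 + s) * p * v →
  p ^ suc c ≤ (u * v) ^ c
rich-bound {p} c {d} 2≤p 2≤d {x} {y} {u} {v} good pop-u pop-v = ℕ.*-cancelˡ-≤ (p ^ suc j) (begin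
  p ^ suc j * p ^ suc c             ≡⟨ ℕ.^-distribˡ-+-* p (suc j) (suc c) ⟨
  p ^ (suc j + suc c)               ≡⟨ cong (p ^_) (exponents c j) ⟩
  p ^ (c + j + 2)                   ≤⟨ ℕ.^-monoʳ-≤ p (ℕ.+-monoʳ-≤ (c + j) 2≤d) ⟩
  p ^ (c + j + d)                   ≤⟨ good ⟩
  (x * y) ^ j                       ≤⟨ ℕ.*-cancelˡ-≤ (s ^ j) scaled ⟩
  2 * (p ^ j * (u * v) ^ c)         ≤⟨ ℕ.*-monoˡ-≤ (p ^ j * (u * v) ^ c) 2≤p ⟩
  p * (p ^ j * (u * v) ^ c)         ≡⟨ ℕ.*-assoc p (p ^ j) _ ⟨
  p ^ suc j * (u * v) ^ c           ∎)
  where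
  open ℕ.≤-Reasoning
  j = c + c
  s = j + j
  instance
    p≢0 : NonZero p
    p≢0 = ℕ.>-nonZero (ℕ.≤-trans (s≤s z≤n) 2≤p)
    j≢0 : NonZero j
    j≢0 = ℕ.>-nonZero (ℕ.≤-trans (ℕ.>-nonZero⁻¹ c) (ℕ.m≤m+n c c))
    s≢0 : NonZero s
    s≢0 = ℕ.>-nonZero (ℕ.≤-trans (ℕ.>-nonZero⁻¹ j) (ℕ.m≤m+n j j))
    s^j≢0 : NonZero (s ^ j)
    s^j≢0 = ℕ.m^n≢0 s j
    p^j≢0 : NonZero (p ^ suc j)
    p^j≢0 = ℕ.m^n≢0 p (suc j)
  exponents : ∀ c j → suc j + suc c ≡ c + j + 2
  exponents = solve-∀
  e₁ : ∀ s x y → s * (x * x) * (s * (y * y)) ≡ s * (x * y) * (s * (x * y))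
  e₁ = solve-∀
  e₂ : ∀ s p u v → (1 + s) * p * u * ((1 + s) * p * v) ≡ (1 + s) * p * ((1 + s) * p) * (u * v)
  e₂ = solve-∀
  e₃ : ∀ S P R → 2 * S * P * R ≡ S * (2 * (P * R))
  e₃ = solve-∀
  -- The two popularity bounds are multiplied and raised to the power `c`; since j = 2c, the square
  -- s x y · s x y becomes a j-th power.
  scaled : s ^ j * (x * y) ^ j ≤ s ^ j * (2 * (p ^ j * (u * v) ^ c))
  scaled = begin
    s ^ j * (x * y) ^ j                                ≡⟨ ^-distribʳ-* j s (x * y) ⟨
    (s * (x * y)) ^ j                                  ≡⟨ square^ (s * (x * y)) c ⟨
    (s * (x * y) * (s * (x * y))) ^ c                  ≡⟨ cong (_^ c) (e₁ s x y) ⟨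
    (s * (x * x) * (s * (y * y))) ^ c                  ≤⟨ ℕ.^-monoˡ-≤ c (ℕ.*-mono-≤ pop-u pop-v) ⟩
    ((1 + s) * p * u * ((1 + s) * p * v)) ^ c          ≡⟨ cong (_^ c) (e₂ s p u v) ⟩
    ((1 + s) * p * ((1 + s) * p) * (u * v)) ^ c        ≡⟨ ^-distribʳ-* c _ (u * v) ⟩
    ((1 + s) * p * ((1 + s) * p)) ^ c * (u * v) ^ c    ≡⟨ cong (_* (u * v) ^ c) (square^ ((1 + s) * p) c) ⟩
    ((1 + s) * p) ^ j * (u * v) ^ c                    ≡⟨ cong (_* (u * v) ^ c) (^-distribʳ-* j (1 + s) p) ⟩
    (1 + s) ^ j * p ^ j * (u * v) ^ c                  ≤⟨ ℕ.*-monoˡ-≤ ((u * v) ^ c) (ℕ.*-monoˡ-≤ (p ^ j) (power-ratio-2 j)) ⟩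
    2 * s ^ j * p ^ j * (u * v) ^ c                    ≡⟨ e₃ (s ^ j) (p ^ j) ((u * v) ^ c) ⟩
    s ^ j * (2 * (p ^ j * (u * v) ^ c))                ∎

-- Families of coset representatives

-- A supply of `N` distinct elements satisfying `P`, in the list form that the conclusion about
-- cosets requires.
record Family {A : Set} (P : A → Set) (N : ℕ) : Set where
  field
    list     : List A
    unique   : Unique list
    all      : All P list
    length≡N : length list ≡ N

length-cartesianProductWith : ∀ {A B C : Set} (f : A → B → C) xs ys →
  length (cartesianProductWith f xs ys) ≡ length xs * length ys
length-cartesianProductWith f List.[] ys = refl
length-cartesianProductWith f (x List.∷ xs) ys = trans (List.length-++ (List.map (f x) ys))
  (cong₂ _+_ (List.length-map (f x) ys) (length-cartesianProductWith f xs ys))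

productFamily : ∀ {A B C : Set} {P : A → Set} {Q : B → Set} {R : C → Set} {M N} (f : A → B → C) →
  (∀ {a a' b b'} → f a b ≡ f a' b' → a ≡ a' × b ≡ b') → (∀ {a b} → P a → Q b → R (f a b)) →
  Family P M → Family Q N → Family R (M * N)
productFamily {A} {B} f inj comb F G = record
  { list     = cartesianProductWith f F.list G.list
  ; unique   = Unique.cartesianProductWith⁺ f inj F.unique G.unique
  ; all      = All.cartesianProductWith⁺ (setoid A) (setoid B) f F.list G.list
                 (λ a∈ b∈ → comb (All.lookup F.all a∈) (All.lookup G.all b∈))
  ; length≡N = trans (length-cartesianProductWith f F.list G.list) (cong₂ _*_ F.length≡N G.length≡N)
  }
  where
  module F = Family F
  module G = Family G

members : ∀ {n} (χ : Fin n → Bool) → Family (λ x → χ x ≡ true) (card χ)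
members {n} χ = record
  { list     = filter χ? (allFin n)
  ; unique   = Unique.filter⁺ χ? (Unique.allFin⁺ n)
  ; all      = All.all-filter χ? (allFin n)
  ; length≡N = count id
  }
  where
  χ? = λ x → χ x Bool.≟ true
  count : ∀ {m} (f : Fin m → Fin n) → length (filter χ? (tabulate f)) ≡ card (χ ∘ f)
  count {zero}  f = refl
  count {suc m} f with χ (f zero)
  ... | true  = cong suc (count (f ∘ suc))
  ... | false = count (f ∘ suc)

-- Trading rich coordinates against sumset growth

gainNeeded : ℕ → ℕ → ℕ
gainNeeded s k = (1 + s) * ((1 + s) * (1 + s)) ^ k

module Selection (p : ℕ) (pr : Prime p) (E s : ℕ) where

  open PrimeField p pr
  open Sumsets p pr
  open Cosets p pr E

  size : Subset p → Subset p → ℕ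
  size X Y = card (lookup X) * card (lookup Y)

  sumsetSize : Subset p → Subset p → ℕ
  sumsetSize X Y = card (sumset (lookup X)) * card (sumset (lookup Y))

  Pairs : Subset p → Subset p → ℕ → Set
  Pairs X Y = Family {Fin p × Fin p} (λ (u , v) → Rich X Y u v)

  -- The index counts the coordinates with a lossless supply of rich pairs and those
  -- where rich pairs cost a constant factor but the sumsets grow by a constant factor.
  data Classified : ℕ → ℕ → ∀ {n} → Vec (Subset p) n → Vec (Subset p) n → Set where
    []     : Classified 0 0 [] []
    plain  : ∀ {f c n X Y} {Xs Ys : Vec (Subset p) n} → size X Y ≤ sumsetSize X Y →
             Classified f c Xs Ys → Classified f c (X ∷ Xs) (Y ∷ Ys)
    free   : ∀ {f c n X Y} {Xs Ys : Vec (Subset p) n} → size X Y ≤ sumsetSize X Y →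
             ∀ {N} → Pairs X Y N → size X Y ≤ N →
             Classified f c Xs Ys → Classified (suc f) c (X ∷ Xs) (Y ∷ Ys)
    costly : ∀ {f c n X Y} {Xs Ys : Vec (Subset p) n} → size X Y ≤ sumsetSize X Y →
             ∀ {N} → Pairs X Y N → size X Y ≤ (1 + s) * (1 + s) * N →
             (2 + s) * size X Y ≤ (1 + s) * sumsetSize X Y →
             Classified f c Xs Ys → Classified f (suc c) (X ∷ Xs) (Y ∷ Ys)

  Selections : ℕ → ∀ {n} → Vec (Subset p) n → Vec (Subset p) n → ℕ → Set
  Selections k {n} X Y = Family {Vec (Fin p) n × Vec (Fin p) n} (λ (u , v) → Selected k X Y u v)

  represented : ∀ X Y → Family {Fin p × Fin p} (λ (u , v) → Represented X u × Represented Y v) (sumsetSize X Y)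
  represented X Y = productFamily _,_ (λ { refl → refl , refl })
    (λ {u} {v} Su Sv → does⇒ (1 ℕ.≤? r (lookup X) u) Su , does⇒ (1 ℕ.≤? r (lookup Y) v) Sv)
    (members (sumset (lookup X))) (members (sumset (lookup Y)))

  private
    _∷²_ : ∀ {n} → Fin p × Fin p → Vec (Fin p) n × Vec (Fin p) n → Vec (Fin p) (suc n) × Vec (Fin p) (suc n)
    (u , v) ∷² (us , vs) = u ∷ us , v ∷ vs

    ∷²-injective : ∀ {n} {a a' : Fin p × Fin p} {b b' : Vec (Fin p) n × Vec (Fin p) n} →
                   a ∷² b ≡ a' ∷² b' → a ≡ a' × b ≡ b'
    ∷²-injective refl = refl , refl

  skipAll : ∀ {k n N X Y} {Xs Ys : Vec (Subset p) n} → Selections k Xs Ys N →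
            Selections k (X ∷ Xs) (Y ∷ Ys) (sumsetSize X Y * N)
  skipAll {X = X} {Y} = productFamily _∷²_ ∷²-injective (λ (ru , rv) → skip ru rv) (represented X Y)

  useAll : ∀ {k n M N X Y} {Xs Ys : Vec (Subset p) n} → Pairs X Y M → Selections k Xs Ys N →
           Selections (suc k) (X ∷ Xs) (Y ∷ Ys) (M * N)
  useAll = productFamily _∷²_ ∷²-injective rich

  total : ∀ {n} → Vec (Subset p) n → Vec (Subset p) n → ℕ
  total []       []       = 1
  total (X ∷ Xs) (Y ∷ Ys) = size X Y * total Xs Ys

  total≡prodSizes : ∀ {n} (X Y : Vec (Subset p) n) → total X Y ≡ prodSizes X * prodSizes Y
  total≡prodSizes []       []       = refl
  total≡prodSizes (X ∷ Xs) (Y ∷ Ys) = trans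
    (cong₂ _*_ (cong₂ _*_ (sym (card-lookup X)) (sym (card-lookup Y))) (total≡prodSizes Xs Ys))
    (ℕ.[m*n]*[o*p]≡[m*o]*[n*p] ∣ X ∣ ∣ Y ∣ (prodSizes Xs) (prodSizes Ys))

  selectNone : Selections 0 [] [] 1
  selectNone = record { list = ([] , []) List.∷ List.[] ; unique = All.[] AllPairs.∷ AllPairs.[]
                      ; all = [] All.∷ All.[] ; length≡N = refl }

  -- The first `k` free coordinates serve as rich ones and all others contribute their whole
  -- sumsets; neither choice loses anything against `size`.
  selectFree : ∀ {k f c n} {X Y : Vec (Subset p) n} → Classified f c X Y → k ≤ f →
               ∃[ N ] Selections k X Y N × total X Y ≤ N
  selectFree {zero} [] _ = 1 , selectNone , ℕ.≤-refl
  selectFree (plain small cl) k≤f with selectFree cl k≤f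
  ... | N , S , le = _ , skipAll S , ℕ.*-mono-≤ small le
  selectFree (costly small _ _ _ cl) k≤f with selectFree cl k≤f
  ... | N , S , le = _ , skipAll S , ℕ.*-mono-≤ small le
  selectFree {zero} (free small _ _ cl) _ with selectFree {zero} cl z≤n
  ... | N , S , le = _ , skipAll S , ℕ.*-mono-≤ small le
  selectFree {suc k} (free _ pairs enough cl) (s≤s k≤f) with selectFree cl k≤f
  ... | N , S , le = _ , useAll pairs S , ℕ.*-mono-≤ enough le

  private
    -- `λ₀` is the loss when a costly coordinate is used as a rich one; (1 + G)/G is the gain when
    -- its sumsets are used instead.
    λ₀ G : ℕ
    λ₀ = (1 + s) * (1 + s)
    G  = 1 + s

    skip-step : ∀ {L W Q T M N} → Q ≤ M → L * T ≤ W * N → L * (Q * T) ≤ W * (M * N)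
    skip-step {L} {W} {Q} {T} {M} {N} Q≤M le = subst₂ _≤_ (e Q L T) (e M W N) (ℕ.*-mono-≤ Q≤M le)
      where
      e : ∀ a b c → a * (b * c) ≡ b * (a * c)
      e = solve-∀

    use-step : ∀ {a l g Q T M N} → Q ≤ λ₀ * M → a * T ≤ l * g * N → a * (Q * T) ≤ λ₀ * l * g * (M * N)
    use-step {a} {l} {g} {Q} {T} {M} {N} Q≤ le = subst₂ _≤_ (e₁ Q a T) (e₂ λ₀ M l g N) (ℕ.*-mono-≤ Q≤ le)
      where
      e₁ : ∀ a b c → a * (b * c) ≡ b * (a * c)
      e₁ = solve-∀
      e₂ : ∀ L M l g N → L * M * (l * g * N) ≡ L * l * g * (M * N)
      e₂ = solve-∀

    gain-step : ∀ {a l g Q T M N} → (1 + G) * Q ≤ G * M → a * T ≤ l * g * N →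
                (1 + G) * a * (Q * T) ≤ l * (G * g) * (M * N)
    gain-step {a} {l} {g} {Q} {T} {M} {N} gain le =
      subst₂ _≤_ (e₁ (1 + G) Q a T) (e₂ G M l g N) (ℕ.*-mono-≤ gain le)
      where
      e₁ : ∀ a b c d → a * b * (c * d) ≡ a * c * (b * d)
      e₁ = solve-∀
      e₂ : ∀ L M l g N → L * M * (l * g * N) ≡ l * (L * g) * (M * N)
      e₂ = solve-∀

  -- The first `k` costly coordinates serve as rich ones and lose `λ₀` each. The next `m` contribute
  -- their sumsets and gain (1 + G)/G each; the remaining ones are skipped without loss.
  selectCostly : ∀ k m {f c n} {X Y : Vec (Subset p) n} → Classified f c X Y → k + m ≤ c →
    ∃[ N ] Selections k X Y N × (1 + G) ^ m * total X Y ≤ λ₀ ^ k * G ^ m * N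
  selectCostly zero zero [] _ = 1 , selectNone , ℕ.≤-refl
  selectCostly k m (plain small cl) km≤c with selectCostly k m cl km≤c
  ... | N , S , le = _ , skipAll S , skip-step {(1 + G) ^ m} {λ₀ ^ k * G ^ m} small le
  selectCostly k m (free small _ _ cl) km≤c with selectCostly k m cl km≤c
  ... | N , S , le = _ , skipAll S , skip-step {(1 + G) ^ m} {λ₀ ^ k * G ^ m} small le
  selectCostly zero zero (costly small _ _ _ cl) _ with selectCostly zero zero cl z≤n
  ... | N , S , le = _ , skipAll S , skip-step {1} {1} small le
  selectCostly zero (suc m) (costly {X = X} {Y} _ _ _ gain cl) (s≤s m≤c) with selectCostly zero m cl m≤c
  ... | N , S , le = _ , skipAll S , gain-step {(1 + G) ^ m} {1} {G ^ m} {size X Y} gain le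
  selectCostly (suc k) m (costly _ {M} pairs cost _ cl) (s≤s km≤c) with selectCostly k m cl km≤c
  ... | N , S , le = _ , useAll pairs S , use-step {(1 + G) ^ m} {λ₀ ^ k} {G ^ m} {M = M} cost le

  select : ∀ k {f c n} {X Y : Vec (Subset p) n} → Classified f c X Y → k + (k + gainNeeded s k) ≤ f + c →
           ∃[ N ] Selections k X Y N × total X Y ≤ N
  select k {f} {c} {X = X} {Y} cl enough with k ℕ.≤? f
  ... | yes k≤f = selectFree cl k≤f
  ... | no  k≰f = N , S , ℕ.*-cancelˡ-≤ ((1 + G) ^ m) (ℕ.≤-trans le (ℕ.*-monoˡ-≤ N (growth-dominates G (λ₀ ^ k))))
    where
    -- This is G · λ₀^k, so by `growth-dominates` the `m` gains outweigh the loss λ₀^k. Fewer than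
    -- `k` free coordinates leave at least k + m costly ones.
    m = gainNeeded s k
    km≤c : k + m ≤ c
    km≤c = ℕ.+-cancelˡ-≤ k _ _ (ℕ.≤-trans enough (ℕ.+-monoˡ-≤ c (ℕ.<⇒≤ (ℕ.≰⇒> k≰f))))
    chosen = selectCostly k m cl km≤c
    N = proj₁ chosen
    S = proj₁ (proj₂ chosen)
    le = proj₂ (proj₂ chosen)
    instance
      pos : NonZero ((1 + G) ^ m)
      pos = ℕ.m^n≢0 (1 + G) m

-- A coordinate is good when |Xᵢ||Yᵢ| ≥ p^(3/2 + ε); here c = 2b and d = 4a, where ε = a / b.
module Classification (p : ℕ) (pr : Prime p) (c d : ℕ) {{_ : NonZero c}} (2≤d : 2 ≤ d) where

  j s e : ℕ
  j = c + c
  s = j + j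
  e = c + j + d

  open PrimeField p pr
  open Sumsets p pr
  open Cosets p pr c
  open Selection p pr c s

  Good : Subset p → Subset p → Set
  Good X Y = p ^ e ≤ size X Y ^ j

  private
    1≤s : 1 ≤ s
    1≤s = ℕ.≤-trans (ℕ.>-nonZero⁻¹ c) (ℕ.≤-trans (ℕ.m≤m+n c c) (ℕ.m≤m+n j j))

    j<e : j < e
    j<e = ℕ.≤-trans (ℕ.+-monoˡ-≤ j (ℕ.>-nonZero⁻¹ c)) (ℕ.m≤m+n (c + j) d)

    -- A factor of size at most 1 would force x y ≤ p, contradicting e > j.
    2≤factor : ∀ {x y} → y ≤ p → p ^ e ≤ (x * y) ^ j → 2 ≤ x
    2≤factor {x} {y} y≤p good with 2 ℕ.≤? x
    ... | yes 2≤x = 2≤x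
    ... | no  2≰x = ⊥-elim (ℕ.<-irrefl refl (begin-strict
      p ^ j         <⟨ ℕ.^-monoʳ-< p 1<p j<e ⟩
      p ^ e         ≤⟨ good ⟩
      (x * y) ^ j   ≤⟨ ℕ.^-monoˡ-≤ j (ℕ.*-mono-≤ (ℕ.≤-pred (ℕ.≰⇒> 2≰x)) y≤p) ⟩
      (1 * p) ^ j   ≡⟨ cong (_^ j) (ℕ.*-identityˡ p) ⟩
      p ^ j         ∎))
      where open ℕ.≤-Reasoning

  popularPairs : ∀ X Y → Good X Y → Pairs X Y (card (popular s (lookup X)) * card (popular s (lookup Y)))
  popularPairs X Y good = productFamily _,_ (λ { refl → refl , refl })
    (λ {u} {v} pu pv → rich-bound c 1<p 2≤d {card (lookup X)} {card (lookup Y)} good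
      (does⇒ (popular? s (lookup X) u) pu) (does⇒ (popular? s (lookup Y) v) pv))
    (members (popular s (lookup X))) (members (popular s (lookup Y)))

  -- If both sets are dense, every pair is popular and hence rich, so the coordinate is free.
  -- Otherwise a sparse set among the two gains the factor (2 + s)/(1 + s) in its sumset, and
  -- averaging supplies the popular pairs.
  extendGood : ∀ X Y → Nonempty X → Nonempty Y → Good X Y →
    ∀ {f k n} {Xs Ys : Vec (Subset p) n} → Classified f k Xs Ys →
    Classified (suc f) k (X ∷ Xs) (Y ∷ Ys) ⊎ Classified f (suc k) (X ∷ Xs) (Y ∷ Ys)
  extendGood X Y (x₀ , x₀∈X) (y₀ , y₀∈Y) good cl = cases
    where
    open ℕ.≤-Reasoning
    χ ψ : Fin p → Bool
    χ = lookup X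
    ψ = lookup Y
    χx₀ : χ x₀ ≡ true
    χx₀ = Vec.[]=⇒lookup x₀∈X
    ψy₀ : ψ y₀ ≡ true
    ψy₀ = Vec.[]=⇒lookup y₀∈Y
    small : size X Y ≤ sumsetSize X Y
    small = ℕ.*-mono-≤ (card≤sumset χ χx₀) (card≤sumset ψ ψy₀)
    pairs = popularPairs X Y good
    cost : size X Y ≤ (1 + s) * (1 + s) * (card (popular s χ) * card (popular s ψ))
    cost = ℕ.≤-trans (ℕ.*-mono-≤ (card≤popular s χ χx₀) (card≤popular s ψ ψy₀))
      (ℕ.≤-reflexive (ℕ.[m*n]*[o*p]≡[m*o]*[n*p] (1 + s) (card (popular s χ)) (1 + s) (card (popular s ψ))))
    popular-full : ∀ χ → (1 + s) * p < (2 + s) * card χ → card χ ≤ card (popular s χ)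
    popular-full χ dense = ℕ.≤-trans (card≤ χ) (ℕ.≤-reflexive (sym
      (card-true (λ u → dec-true (popular? s χ u) (dense⇒popular s χ dense u)))))
    cases : _
    cases with (1 + s) * p ℕ.<? (2 + s) * card χ | (1 + s) * p ℕ.<? (2 + s) * card ψ
    ... | yes χ-dense | yes ψ-dense =
      inj₁ (free small pairs (ℕ.*-mono-≤ (popular-full χ χ-dense) (popular-full ψ ψ-dense)) cl)
    ... | no χ-sparse | _ = inj₂ (costly small pairs cost (begin
      (2 + s) * (card χ * card ψ)                            ≡⟨ ℕ.*-assoc (2 + s) (card χ) (card ψ) ⟨
      (2 + s) * card χ * card ψ
        ≤⟨ ℕ.*-mono-≤ (sumset-growth s χ 1≤s (2≤factor (card≤ ψ) good) (ℕ.≮⇒≥ χ-sparse)) (card≤sumset ψ ψy₀) ⟩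
      (1 + s) * card (sumset χ) * card (sumset ψ)            ≡⟨ ℕ.*-assoc (1 + s) (card (sumset χ)) (card (sumset ψ)) ⟩
      (1 + s) * (card (sumset χ) * card (sumset ψ))          ∎) cl)
    ... | yes _ | no ψ-sparse = inj₂ (costly small pairs cost (begin
      (2 + s) * (card χ * card ψ)                            ≡⟨ swap (2 + s) (card χ) (card ψ) ⟩
      card χ * ((2 + s) * card ψ)
        ≤⟨ ℕ.*-mono-≤ (card≤sumset χ χx₀) (sumset-growth s ψ 1≤s (2≤factor (card≤ χ) good') (ℕ.≮⇒≥ ψ-sparse)) ⟩
      card (sumset χ) * ((1 + s) * card (sumset ψ))          ≡⟨ swap (1 + s) (card (sumset χ)) (card (sumset ψ)) ⟨
      (1 + s) * (card (sumset χ) * card (sumset ψ))          ∎) cl)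
      where
      swap : ∀ a b c → a * (b * c) ≡ b * (a * c)
      swap = solve-∀
      good' : p ^ e ≤ (card ψ * card χ) ^ j
      good' = subst (λ q → p ^ e ≤ q ^ j) (ℕ.*-comm (card χ) (card ψ)) good

  private
    -- A good coordinate is estimated trivially by |X||Y| ≤ p², adding 2j to the exponent. The
    -- exponent `e` is granted as well, so that all coordinates are charged uniformly.
    good-bound : ∀ X Y n g {T} → T ^ j ≤ p ^ (n * e + (j + j) * g) →
                 (size X Y * T) ^ j ≤ p ^ (suc n * e + (j + j) * suc g)
    good-bound X Y n g {T} bound = begin
      (size X Y * T) ^ j                           ≡⟨ ^-distribʳ-* j (size X Y) T ⟩
      size X Y ^ j * T ^ j                         ≤⟨ ℕ.*-mono-≤ (ℕ.^-monoˡ-≤ j (ℕ.*-mono-≤ (card≤ (lookup X)) (card≤ (lookup Y)))) bound ⟩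
      (p * p) ^ j * p ^ (n * e + (j + j) * g)      ≡⟨ cong (_* p ^ (n * e + (j + j) * g)) (square^ p j) ⟩
      p ^ (j + j) * p ^ (n * e + (j + j) * g)      ≡⟨ ℕ.^-distribˡ-+-* p (j + j) _ ⟨
      p ^ (j + j + (n * e + (j + j) * g))          ≤⟨ ℕ.^-monoʳ-≤ p (ℕ.m≤n+m _ e) ⟩
      p ^ (e + (j + j + (n * e + (j + j) * g)))    ≡⟨ cong (p ^_) (exponents e (j + j) (n * e) g) ⟩
      p ^ (suc n * e + (j + j) * suc g)            ∎
      where
      open ℕ.≤-Reasoning
      exponents : ∀ e J m g → e + (J + (m + J * g)) ≡ e + m + J * suc g
      exponents = solve-∀

  -- Exactly the good coordinates are counted in f + k. The attached bound shows that few of them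
  -- would make the brick small: each other coordinate contributes less than p^e to the j-th power.
  classify : ∀ {n} (X Y : Vec (Subset p) n) →
    (∀ i → Nonempty (lookup X i)) → (∀ i → Nonempty (lookup Y i)) →
    ∃[ f ] ∃[ k ] Classified f k X Y × total X Y ^ j ≤ p ^ (n * e + (j + j) * (f + k))
  classify [] [] _ _ = 0 , 0 , [] , ℕ.≤-reflexive (trans (ℕ.^-zeroˡ j) (sym (cong (p ^_) (ℕ.*-zeroʳ (j + j)))))
  classify {suc n} (X ∷ Xs) (Y ∷ Ys) neX neY
    with classify Xs Ys (neX ∘ suc) (neY ∘ suc) | p ^ e ℕ.≤? size X Y ^ j
  ... | f , k , cl , bound | no ¬good = f , k , plain small cl , (begin
    (size X Y * total Xs Ys) ^ j                       ≡⟨ ^-distribʳ-* j (size X Y) (total Xs Ys) ⟩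
    size X Y ^ j * total Xs Ys ^ j                     ≤⟨ ℕ.*-mono-≤ (ℕ.<⇒≤ (ℕ.≰⇒> ¬good)) bound ⟩
    p ^ e * p ^ (n * e + (j + j) * (f + k))            ≡⟨ ℕ.^-distribˡ-+-* p e _ ⟨
    p ^ (e + (n * e + (j + j) * (f + k)))              ≡⟨ cong (p ^_) (ℕ.+-assoc e (n * e) _) ⟨
    p ^ (suc n * e + (j + j) * (f + k))                ∎)
    where
    open ℕ.≤-Reasoning
    small : size X Y ≤ sumsetSize X Y
    small = ℕ.*-mono-≤ (card≤sumset (lookup X) (Vec.[]=⇒lookup (proj₂ (neX zero))))
                       (card≤sumset (lookup Y) (Vec.[]=⇒lookup (proj₂ (neY zero))))
  ... | f , k , cl , bound | yes good with extendGood X Y (neX zero) (neY zero) good cl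
  ...   | inj₁ cl' = suc f , k , cl' , good-bound X Y n (f + k) bound
  ...   | inj₂ cl' = f , suc k , cl' , subst (λ g → (size X Y * total Xs Ys) ^ j ≤ p ^ (suc n * e + (j + j) * g)) (sym (ℕ.+-suc f k))
                       (good-bound X Y n (f + k) bound)

-- Thresholds and conclusion

goodNeeded : ℕ → ℕ
goodNeeded b = k + (k + gainNeeded s k)
  where
  k = suc (2 * (b + b))
  s = (b + b + (b + b)) + (b + b + (b + b))

-- With j = 4b, this is the exponent j granted to `Z` plus 2j for each of `goodNeeded b` good
-- coordinates.
threshold : ℕ → ℕ
threshold b = 4 * b + 8 * b * goodNeeded b

theorem1p2 : ∀ (a b : ℕ) → 0 < a → 0 < b →
    ∃[ n₀ ] (0 < n₀ × (∀ (p : ℕ) (pr : Prime p) (n : ℕ) → n₀ ≤ n →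
    (B : Brick p n) → NonemptyBrick B →
    orderM {p} {{prime⇒nonZero pr}} n ^ (3 * b + 4 * a) < brickSize B ^ (4 * b) →
    ContainsAtLeastCosetsOver-p {p} {{prime⇒nonZero pr}} B (brickSize B)))
theorem1p2 a@(suc a') b@(suc b') 0<a 0<b = threshold b , s≤s z≤n , main
  where
  main : ∀ (p : ℕ) (pr : Prime p) (n : ℕ) → threshold b ≤ n →
    (B : Brick p n) → NonemptyBrick B →
    orderM {p} {{prime⇒nonZero pr}} n ^ (3 * b + 4 * a) < brickSize B ^ (4 * b) →
    ContainsAtLeastCosetsOver-p {p} {{prime⇒nonZero pr}} B (brickSize B)
  main p pr n n₀≤n B (neX , neY , neZ) big = F.list , F.unique , All.map (cosetIn B neZ) F.all , enough
    where
    open ℕ.≤-Reasoning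
    open PrimeField p pr using (p≢0)
    open Classification p pr (b + b) (4 * a) (ℕ.*-mono-≤ {2} {4} {1} (s≤s (s≤s z≤n)) 0<a)
    open Cosets p pr (b + b) using (1<p; cosetIn)
    open Selection p pr (b + b) s using (total; total≡prodSizes; select)
    classified = classify (X B) (Y B) neX neY
    f = proj₁ classified
    k = proj₁ (proj₂ classified)
    bound = proj₂ (proj₂ (proj₂ classified))
    g = f + k

    T≡ : brickSize B ≡ total (X B) (Y B) * ∣ Z B ∣
    T≡ = cong (_* ∣ Z B ∣) (sym (total≡prodSizes (X B) (Y B)))

    |B|≤ : brickSize B ^ (4 * b) ≤ p ^ (n * e + (j + j) * g + j)
    |B|≤ = begin
      brickSize B ^ (4 * b)                        ≡⟨ cong₂ _^_ T≡ (4b b) ⟩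
      (total (X B) (Y B) * ∣ Z B ∣) ^ j            ≡⟨ ^-distribʳ-* j (total (X B) (Y B)) ∣ Z B ∣ ⟩
      total (X B) (Y B) ^ j * ∣ Z B ∣ ^ j          ≤⟨ ℕ.*-mono-≤ bound (ℕ.^-monoˡ-≤ j (Subset.∣p∣≤n (Z B))) ⟩
      p ^ (n * e + (j + j) * g) * p ^ j            ≡⟨ ℕ.^-distribˡ-+-* p (n * e + (j + j) * g) j ⟨
      p ^ (n * e + (j + j) * g + j)                ∎
      where
      4b : ∀ b → 4 * b ≡ b + b + (b + b)
      4b = solve-∀

    -- The hypothesis puts |B|^(4b) above p^((2n + 1)(3b + 4a)), an exponent exceeding n e = n (6b +
    -- 4a) by more than 4an ≥ n. Few good coordinates allow an excess of at most `threshold b` ≤ n.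
    few-good-absurd : ¬ (g ≤ goodNeeded b)
    few-good-absurd g≤ = ℕ.<-irrefl refl (ℕ.<-≤-trans big (ℕ.≤-trans |B|≤ (begin
      p ^ (n * e + (j + j) * g + j)                ≤⟨ ℕ.^-monoʳ-≤ p exponents ⟩
      p ^ ((2 * n + 1) * (3 * b + 4 * a))          ≡⟨ ℕ.^-*-assoc p (2 * n + 1) (3 * b + 4 * a) ⟨
      orderM {p} n ^ (3 * b + 4 * a)               ∎)))
      where
      e₁ : ∀ m b g → m + (b + b + (b + b) + (b + b + (b + b))) * g + (b + b + (b + b)) ≡ m + (4 * b + 8 * b * g)
      e₁ = solve-∀
      e₂ : ∀ n b a' → n * (b + b + (b + b + (b + b)) + 4 * suc a') + n + (n * (3 + 4 * a') + (3 * b + 4 * suc a')) ≡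
                      (2 * n + 1) * (3 * b + 4 * suc a')
      e₂ = solve-∀
      exponents : n * e + (j + j) * g + j ≤ (2 * n + 1) * (3 * b + 4 * a)
      exponents = begin
        n * e + (j + j) * g + j                     ≡⟨ e₁ (n * e) b g ⟩
        n * e + (4 * b + 8 * b * g)                 ≤⟨ ℕ.+-monoʳ-≤ (n * e) (ℕ.+-monoʳ-≤ (4 * b) (ℕ.*-monoʳ-≤ (8 * b) g≤)) ⟩
        n * e + threshold b                         ≤⟨ ℕ.+-monoʳ-≤ (n * e) n₀≤n ⟩
        n * e + n                                   ≤⟨ ℕ.m≤m+n (n * e + n) _ ⟩
        n * e + n + (n * (3 + 4 * a') + (3 * b + 4 * a))   ≡⟨ e₂ n b a' ⟩
        (2 * n + 1) * (3 * b + 4 * a)               ∎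

    -- 2E + 1 rich coordinates, with E = 2b, are what `reachAll` requires.
    selected = select (suc (2 * (b + b))) (proj₁ (proj₂ (proj₂ classified))) (ℕ.<⇒≤ (ℕ.≰⇒> few-good-absurd))
    module F = Family (proj₁ (proj₂ selected))

    enough : brickSize B ≤ length F.list * p
    enough = begin
      brickSize B                          ≡⟨ T≡ ⟩
      total (X B) (Y B) * ∣ Z B ∣          ≤⟨ ℕ.*-mono-≤ (proj₂ (proj₂ selected)) (Subset.∣p∣≤n (Z B)) ⟩
      proj₁ selected * p                   ≡⟨ cong (_* p) F.length≡N ⟨
      length F.list * p                    ∎
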